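{- Let $b$ be a graph over $(X,m)$. For all $p\in(1,\infty)$, $$\frac{2^{p-1}}{p^{p}}\,\bigl(h^{(0)}_{p}\bigr)^{p}\leq \lambda^{(0)}_{p}.$$
   Context: Setting: $X$ is a nonempty countable (finite or infinite) set, $C(X)$ is the space of real-valued functions on $X$ and $C_c(X)$ the subspace of finitely supported functions. A graph $b$ over $(X,m)$ consists of a symmetric function $b:X\times X\to[0,\infty)$ with $b(x,x)=0$ and $\sum_{y\in X}b(x,y)<\infty$ for all $x\in X$, and a function $m:X\to(0,\infty)$, extended to a measure on subsets by $m(W)=\sum_{x\in W}m(x)$. No connectedness or boundedness assumption is made. $\|f\|_{m,p}=\bigl(\sum_{x\in X}|f(x)|^p m(x)\bigr)^{1/p}$. Energy: $\mathcal{E}_p(f)=\frac12\sum_{x,y\in X}b(x,y)|f(x)-f(y)|^p\in[0,\infty]$ for $f\in C(X)$, and $$\lambda^{(0)}_p=\inf_{0\neq\varphi\in C_c(X)}\frac{\mathcal{E}_p(\varphi)}{\|\varphi\|_{m,p}^p}.$$ For $p\in(1,\infty)$, $R_p(b,m)$ is the set of all symmetric functions $d:X\times X\to[0,\infty)$ such that $\sum_{y\in X}b(x,y)d(x,y)^{p/(p-1)}\le m(x)$ for all $x\in X$. For $W\subseteq X$, $\partial W=W\times(X\setminus W)$, and for $d:X\times X\to[0,\infty)$, $|\partial W|_{bd}=\sum_{(x,y)\in\partial W}b(x,y)d(x,y)$. The isoperimetric constants are $$h^{(0)}(d)=\inf_{\emptyset\ne W\subseteq X\text{ finite}}\frac{|\partial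 W|_{bd}}{m(W)},\qquad h^{(0)}_p=\sup_{d\in R_p(b,m)}h^{(0)}(d).$$ -}

module Defs where

open import Level using (0ℓ) renaming (suc to lsuc)
open import Algebra.Bundles using (CommutativeRing; Semiring)
open import Algebra.Structures using (IsCommutativeRing)
import Algebra.Construct.NaturalChoice.Max as Max
import Algebra.Definitions.RawSemiring as RawSemiringDefinitions
open import Axiom.ExcludedMiddle using (ExcludedMiddle)
open import Data.Empty using (⊥-elim)
open import Data.List.Base using (List; []; foldr; map)
open import Data.List.Membership.Propositional using (_∈_)
open import Data.List.Relation.Unary.All using (All)
open import Data.List.Relation.Unary.Unique.Propositional using (Unique)
open import Data.Nat.Base using (ℕ; suc)
open import Data.Product.Base using (∃; _×_; _,_; proj₁)
open import Relation.Binary.Bundles using (TotalOrder)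
open import Relation.Binary.Structures using (IsTotalOrder)
import Relation.Binary.Construct.NonStrictToStrict as ToStrict
import Relation.Binary.Construct.Add.Extrema.NonStrict as AddExtrema
import Relation.Binary.Construct.Add.Supremum.NonStrict as Supremum≤
open import Relation.Binary.PropositionalEquality.Core using (_≡_; _≢_; refl)
open import Relation.Nullary.Construct.Add.Extrema using (_±; ⊥±; [_]; ⊤±)
open import Relation.Nullary.Negation.Core using (¬_)
open import Relation.Nullary.Decidable.Core using (yes; no)
open import Relation.Unary using (Pred; U)

-- The real numbers, up to isomorphism: every nonempty subset that is bounded
-- above has a least upper bound.  The value of 0# ⁻¹ is left unspecified.
record CompleteOrderedField : Set (lsuc 0ℓ) where
  infix  8 -_ _⁻¹
  infixl 7 _*_ _/_
  infixl 6 _+_ _-_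
  infix  4 _≤_
  field
    ℝ                 : Set
    _+_ _*_           : ℝ → ℝ → ℝ
    -_ _⁻¹            : ℝ → ℝ
    0# 1#             : ℝ
    _≤_               : ℝ → ℝ → Set
    isCommutativeRing : IsCommutativeRing _≡_ _+_ _*_ -_ 0# 1#
    0≢1               : 0# ≢ 1#
    ⁻¹-inverseʳ       : ∀ x → x ≢ 0# → x * (x ⁻¹) ≡ 1#
    isTotalOrder      : IsTotalOrder _≡_ _≤_
    +-monoʳ-≤         : ∀ z {x y} → x ≤ y → (z + x) ≤ (z + y)
    *-nonNegative     : ∀ {x y} → 0# ≤ x → 0# ≤ y → 0# ≤ (x * y)
    complete          : (S : Pred ℝ 0ℓ) → ∃ S → (∃ λ u → ∀ x → S x → x ≤ u) →
                        ∃ λ s → (∀ x → S x → x ≤ s) ×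
                                (∀ u → (∀ x → S x → x ≤ u) → s ≤ u)

  _-_ : ℝ → ℝ → ℝ
  x - y = x + - y

  _/_ : ℝ → ℝ → ℝ
  x / y = x * y ⁻¹

  2# : ℝ
  2# = 1# + 1#

  commutativeRing : CommutativeRing 0ℓ 0ℓ
  commutativeRing = record { isCommutativeRing = isCommutativeRing }

  totalOrder : TotalOrder 0ℓ 0ℓ 0ℓ
  totalOrder = record { isTotalOrder = isTotalOrder }

  open RawSemiringDefinitions (Semiring.rawSemiring (CommutativeRing.semiring commutativeRing)) public
    using () renaming (_^_ to _^ℕ_; _×_ to _×ℕ_)
  open Max totalOrder public using (_⊔_)
  open ToStrict _≡_ _≤_ public using (_<_)

  ∣_∣ : ℝ → ℝ
  ∣ x ∣ = x ⊔ (- x)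

module Analysis (lem : ExcludedMiddle 0ℓ) (𝓡 : CompleteOrderedField) where

  open CompleteOrderedField 𝓡
  open AddExtrema _≤_ using (_≤⊤±; ⊥±≤_; [≤]-injective; ≤±-trans)
    renaming ([_] to lift)
  open AddExtrema _≤_ public using (_≤±_)
  private module ≤ = IsTotalOrder isTotalOrder

  infixr 8 _^_ _^±_
  infixl 7 _·_ _÷_

  ℝ̄ : Set
  ℝ̄ = ℝ ±

  IsSupremum IsInfimum : Pred ℝ̄ 0ℓ → Pred ℝ̄ 0ℓ
  IsSupremum S s = (∀ x → S x → x ≤± s) × (∀ u → (∀ x → S x → x ≤± u) → s ≤± u)
  IsInfimum  S i = (∀ x → S x → i ≤± x) × (∀ l → (∀ x → S x → l ≤± x) → l ≤± i)

  supremum : (S : Pred ℝ̄ 0ℓ) → ∃ (IsSupremum S)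
  supremum S with lem {P = ∃ λ r → ∀ x → S x → x ≤± [ r ]}
  ... | no unbounded = ⊤± , (λ x _ → x ≤⊤±) , least
    where
    least : ∀ u → (∀ x → S x → x ≤± u) → ⊤± ≤± u
    least ⊤±    _  = ⊤± ≤⊤±
    least [ r ] ub = ⊥-elim (unbounded (r , ub))
    least ⊥±    ub = ⊥-elim (unbounded
      (0# , λ x x∈S → ≤±-trans ≤.trans (ub x x∈S) (⊥±≤ [ 0# ])))
  ... | yes (r , bound) with lem {P = ∃ λ a → S [ a ]}
  ...   | no empty = ⊥± , upper , λ u _ → ⊥±≤ u
    where
    upper : ∀ x → S x → x ≤± ⊥±
    upper ⊥±    _   = ⊥±≤ ⊥±
    upper [ a ] a∈S = ⊥-elim (empty (a , a∈S))
    upper ⊤±    ∞∈S with bound ⊤± ∞∈S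
    ... | ()
  ...   | yes (a , a∈S)
    with complete (λ x → S [ x ]) (a , a∈S) (r , λ x x∈S → [≤]-injective (bound [ x ] x∈S))
  ...     | s , s-upper , s-least = [ s ] , upper , least
    where
    upper : ∀ x → S x → x ≤± [ s ]
    upper ⊥±    _   = ⊥±≤ [ s ]
    upper [ x ] x∈S = lift (s-upper x x∈S)
    upper ⊤±    ∞∈S with bound ⊤± ∞∈S
    ... | ()
    least : ∀ u → (∀ x → S x → x ≤± u) → [ s ] ≤± u
    least ⊤±    _  = [ s ] ≤⊤±
    least [ u ] ub = lift (s-least u λ x x∈S → [≤]-injective (ub [ x ] x∈S))
    least ⊥±    ub with ub [ a ] a∈S
    ... | Supremum≤.[ () ]

  infimum : (S : Pred ℝ̄ 0ℓ) → ∃ (IsInfimum S)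
  infimum S with supremum (λ l → ∀ x → S x → l ≤± x)
  ... | i , upper , least =
    i , (λ x x∈S → least x (λ l l-lower → l-lower x x∈S)) , upper

  sup[_] inf[_] : {I : Set} → Pred I 0ℓ → (I → ℝ̄) → ℝ̄
  sup[ P ] f = proj₁ (supremum λ r → ∃ λ i → P i × r ≡ f i)
  inf[ P ] f = proj₁ (infimum  λ r → ∃ λ i → P i × r ≡ f i)

  -- For x ≥ 1, x ^ p is the supremum of x^(m/n) over all rationals m/n ≤ p,
  -- where x^(m/n) is in turn the supremum of the y ≥ 0 with yⁿ ≤ x^m (n = suc k).
  BelowPower : ℝ → ℝ → Pred ℝ 0ℓ
  BelowPower x p y = 0# ≤ y × ∃ λ m → ∃ λ k →
    ((m ×ℕ 1#) ≤ (suc k ×ℕ p)) × ((y ^ℕ suc k) ≤ (x ^ℕ m))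

  -- Only used for the supremum of a nonempty bounded set of reals, which is finite.
  toℝ : ℝ̄ → ℝ
  toℝ [ r ] = r
  toℝ ⊥±    = 0#
  toℝ ⊤±    = 0#

  x≥1-power : ℝ → ℝ → ℝ
  x≥1-power x p = toℝ (sup[ BelowPower x p ] [_])

  -- Only meaningful for x ≥ 0 and p > 0.
  _^_ : ℝ → ℝ → ℝ
  x ^ p with lem {P = x ≡ 0#} | lem {P = 1# ≤ x}
  ... | yes _ | _     = 0#
  ... | no  _ | yes _ = x≥1-power x p
  ... | no  _ | no  _ = (x≥1-power (x ⁻¹) p) ⁻¹

  -- The following operations are only meaningful on [0,∞]; the value at ⊥± = -∞
  -- is arbitrary.

  _^±_ : ℝ̄ → ℝ → ℝ̄
  [ x ] ^± p = [ x ^ p ]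
  ⊤±    ^± p = ⊤±
  ⊥±    ^± p = ⊥±

  -- only for c > 0, so that c · ∞ = ∞
  _·_ : ℝ → ℝ̄ → ℝ̄
  c · [ x ] = [ c * x ]
  c · ⊤±    = ⊤±
  c · ⊥±    = ⊥±

  -- only for divisors in (0,∞]
  _÷_ : ℝ̄ → ℝ̄ → ℝ̄
  x     ÷ ⊤±    = [ 0# ]
  [ x ] ÷ [ y ] = [ x / y ]
  ⊤±    ÷ [ y ] = ⊤±
  ⊥±    ÷ [ y ] = ⊥±
  x     ÷ ⊥±    = ⊥±

  -- The sum in [0,∞] of a function f ≥ 0 over a subset P of its domain: the
  -- supremum of the sums over the finite subsets of P.
  ∑[_] : {I : Set} → Pred I 0ℓ → (I → ℝ) → ℝ̄
  ∑[ P ] f = sup[ (λ is → Unique is × All P is) ] λ is → [ foldr _+_ 0# (map f is) ]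

  record Graph (X : Set) : Set where
    field
      b           : X → X → ℝ
      b-nonneg    : ∀ x y → 0# ≤ b x y
      b-sym       : ∀ x y → b x y ≡ b y x
      b-diagonal  : ∀ x → b x x ≡ 0#
      b-summable  : ∀ x → ∑[ U ] (b x) ≢ ⊤±
      m           : X → ℝ
      m-pos       : ∀ x → 0# < m x

    measure : Pred X 0ℓ → ℝ̄
    measure W = ∑[ W ] m

    FinitelySupported : Pred (X → ℝ) 0ℓ
    FinitelySupported f = ∃ λ (xs : List X) → ∀ x → f x ≢ 0# → x ∈ xs

    ‖_‖[_] : (X → ℝ) → ℝ → ℝ̄
    ‖ f ‖[ p ] = (∑[ U ] λ x → ∣ f x ∣ ^ p * m x) ^± (1# / p)

    energy : ℝ → (X → ℝ) → ℝ̄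
    energy p f = (1# / 2#) · ∑[ U ] λ ((x , y) : X × X) → b x y * ∣ f x - f y ∣ ^ p

    λ₀ : ℝ → ℝ̄
    λ₀ p = inf[ (λ φ → FinitelySupported φ × ∃ λ x → φ x ≢ 0#) ] λ φ →
      energy p φ ÷ ‖ φ ‖[ p ] ^± p

    R : ℝ → Pred (X → X → ℝ) 0ℓ
    R p d = (∀ x y → 0# ≤ d x y) × (∀ x y → d x y ≡ d y x) ×
      (∀ x → ∑[ U ] (λ y → b x y * d x y ^ (p / (p - 1#))) ≤± [ m x ])

    ∂ : Pred X 0ℓ → Pred (X × X) 0ℓ
    ∂ W (x , y) = W x × ¬ W y

    ∣∂_∣ : Pred X 0ℓ → (X → X → ℝ) → ℝ̄
    ∣∂ W ∣ d = ∑[ ∂ W ] λ (x , y) → b x y * d x y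

    -- The finite subsets of X are the sets of elements of lists;
    -- repetitions in a list do not matter.
    h₀-of : (X → X → ℝ) → ℝ̄
    h₀-of d = inf[ (λ xs → xs ≢ []) ] λ (xs : List X) →
      ∣∂ (_∈ xs) ∣ d ÷ measure (_∈ xs)

    h₀ : ℝ → ℝ̄
    h₀ p = sup[ R p ] h₀-of

-- The inequality comes from one pointwise estimate, valid for all α, β, s ≥ 0:
--   2 s^(p-1) |α^p - β^p| ≤ 2 |α - β|^p + (p-1) s^p (α^p + β^p).
-- Integrating Young's inequality p δ (s t)^(p-1) ≤ δ^p + (p-1) (s t)^p, δ = |α - β|, over t ∈ [β , α] gives it,
-- because the convex function t^p has mean at most (α^p + β^p) / 2 there; Riemann sums replace the integral.
-- Now let φ be finitely supported, N = ‖φ‖_p^p, d ∈ R_p, and h < h₀(d). The layer-cake formula for f = |φ|^p turns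
-- h m(W) ≤ |∂W|_{bd} into h N ≤ ½ Σ b d |f x - f y|. Apply the estimate with s^(p-1) = τ^(p-1) d, that is
-- s^p = τ^p d^(p/(p-1)), and sum: since Σ_y b d^(p/(p-1)) ≤ m, it follows that 2 h τ^(p-1) N ≤ 2 E + (p-1) τ^p N.
-- The choice τ = 2h/p makes this τ^p N ≤ 2 E, which is the claim.
-- Real powers are handled through x ^ p = exp₂ (p log₂ x), where log₂ x is the supremum of the rationals (a - b) / n
-- with 2^a ≤ 2^b x^n and exp₂ is its inverse.

module Submission where

-- Young's inequality with the free parameter τ stands in for Hölder's inequality: every estimate
-- stays linear in finite sums, and τ is fixed last. For h > 0 the value 2h/p maximises 2hτ^(p-1) -
-- (p-1)τ^p, so the choice is optimal. Taking the mean of α^p and β^p in the pointwise estimate also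
-- matters for the constant: bounding t^p by its maximum α^p would double the vertex term. The
-- boundary of a finite set may be infinite, and all sums over it are suprema. With h strictly below
-- h₀(d), some finite set of boundary edges already carries h m(W), so the layer-cake argument meets
-- finite families only; the passage from h to h₀(d) is made by contradiction at the end. Since x ^
-- p is a supremum of rational powers, no derivative is used. Bernoulli's inequality is proved for
-- integer exponents and carried to real ones by approximation; tangent lines, Young's inequality
-- and convexity are rescaled forms of it.

open import Defs
open import Level using (0ℓ)
open import Axiom.ExcludedMiddle using (ExcludedMiddle)
open import Algebra.Bundles using (CommutativeRing)
import Algebra.Construct.NaturalChoice.Max
import Algebra.Properties.CommutativeSemiring.Exp
import Algebra.Properties.Ring
import Algebra.Properties.Semiring.Exp
import Algebra.Properties.Semiring.Mult
import Algebra.Properties.Semiring.Mult.TCOptimised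
import Algebra.Solver.Ring
open import Algebra.Solver.Ring.AlmostCommutativeRing using (fromCommutativeRing; _-Raw-AlmostCommutative⟶_)
open import Data.Empty using (⊥-elim)
import Data.Integer.Base as ℤ
import Data.Integer.Properties as ℤ
open import Data.List.Base using (List; []; _∷_; _++_; length; filter; foldr; map; cartesianProduct; deduplicate)
open import Data.List.Membership.Propositional using (_∈_; lose)
open import Data.List.Membership.Propositional.Properties
open import Data.List.Properties using (filter-notAll)
open import Data.List.Relation.Unary.All as All using (All; []; _∷_)
open import Data.List.Relation.Unary.AllPairs using ([]; _∷_)
open import Data.List.Relation.Unary.Any using (here; there)
open import Data.List.Relation.Unary.Unique.Propositional using (Unique)
import Data.List.Relation.Unary.Unique.DecPropositional.Properties as Unique using (deduplicate-!)
import Data.List.Relation.Unary.Unique.Propositional.Properties as Unique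
import Data.Maybe.Base as Maybe
open import Data.Nat.Base as ℕ using (ℕ; zero; suc; z≤n; s≤s)
import Data.Nat.Properties as ℕ
open import Data.Product.Base using (∃; _×_; _,_; proj₁; proj₂)
open import Data.Sum.Base using (_⊎_; inj₁; inj₂)
open import Data.Unit.Base using (tt)
open import Function.Bundles using (_↣_)
import Relation.Binary.Construct.Add.Extrema.NonStrict as AddExtrema
import Relation.Binary.Construct.Add.Supremum.NonStrict as Supremum≤
open import Relation.Binary.Bundles using (TotalOrder)
open import Relation.Binary.Consequences using (dec⇒weaklyDec)
open import Relation.Binary.Definitions using (DecidableEquality)
open import Relation.Binary.PropositionalEquality using (_≡_; _≢_; refl; sym; trans; cong; cong₂; subst; subst₂; module ≡-Reasoning)
import Relation.Binary.Reasoning.PartialOrder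
open import Relation.Binary.Structures using (IsTotalOrder)
open import Relation.Nullary.Construct.Add.Extrema using (⊥±; [_]; ⊤±)
open import Relation.Nullary.Decidable.Core using (Dec; yes; no)
open import Relation.Nullary.Negation.Core using (¬_)
open import Relation.Unary using (Pred; U)

-- Ring identities with integer coefficients.

-- The solver has to compute with coefficients, which is impossible in ℝ; integers suffice.
module IntegerCoefficients {c ℓ} (R : CommutativeRing c ℓ) where

  open CommutativeRing R renaming (refl to ≈-refl; sym to ≈-sym; trans to ≈-trans)
  open Algebra.Properties.Ring ring
  open Algebra.Properties.Semiring.Mult.TCOptimised semiring renaming
      (_×_ to _×′_; ×-homo-+ to ×′-homo-+; ×1-homo-* to ×′1-homo-*)
  open import Relation.Binary.Reasoning.Setoid setoid

  -- The optimised multiple has no trailing zero summand: 1 and 2 evaluate to `1#` and `1# + 1#`, so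
  -- that the constants `:1` and `:2` match the goals by computation.
  fromℤ : ℤ.ℤ → Carrier
  fromℤ (ℤ.+ n)      = n ×′ 1#
  fromℤ ℤ.-[1+ n ] = - (suc n ×′ 1#)

  private
    ⟦_⟧ : ℕ → Carrier
    ⟦ n ⟧ = n ×′ 1#

    ⟦1+⟧ : ∀ n → ⟦ suc n ⟧ ≈ 1# + ⟦ n ⟧
    ⟦1+⟧ n = ×′-homo-+ 1# 1 n

    cancel : ∀ x y z → (x + y) - (x + z) ≈ y - z
    cancel x y z = begin
      (x + y) - (x + z)        ≈⟨ +-cong (+-comm x y) (≈-sym (-‿+-comm x z)) ⟩
      (y + x) + (- x + - z)    ≈⟨ +-assoc y x (- x + - z) ⟩
      y + (x + (- x + - z))    ≈⟨ +-congˡ (≈-sym (+-assoc x (- x) (- z))) ⟩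
      y + ((x - x) + - z)      ≈⟨ +-congˡ (+-congʳ (-‿inverseʳ x)) ⟩
      y + (0# + - z)           ≈⟨ +-congˡ (+-identityˡ (- z)) ⟩
      y - z                    ∎

    fromℤ-⊖ : ∀ m n → fromℤ (m ℤ.⊖ n) ≈ ⟦ m ⟧ - ⟦ n ⟧
    fromℤ-⊖ m zero = ≈-sym (≈-trans (+-congˡ -0#≈0#) (+-identityʳ ⟦ m ⟧))
    fromℤ-⊖ zero (suc n) = ≈-sym (+-identityˡ (- ⟦ suc n ⟧))
    fromℤ-⊖ (suc m) (suc n) = begin
      fromℤ (suc m ℤ.⊖ suc n)          ≡⟨ cong fromℤ (ℤ.[1+m]⊖[1+n]≡m⊖n m n) ⟩
      fromℤ (m ℤ.⊖ n)                  ≈⟨ fromℤ-⊖ m n ⟩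
      ⟦ m ⟧ - ⟦ n ⟧                    ≈⟨ cancel 1# ⟦ m ⟧ ⟦ n ⟧ ⟨
      (1# + ⟦ m ⟧) - (1# + ⟦ n ⟧)      ≈⟨ +-cong (⟦1+⟧ m) (-‿cong (⟦1+⟧ n)) ⟨
      ⟦ suc m ⟧ - ⟦ suc n ⟧            ∎

    fromℤ-+ : ∀ i j → fromℤ (i ℤ.+ j) ≈ fromℤ i + fromℤ j
    fromℤ-+ ℤ.-[1+ m ] ℤ.-[1+ n ] = begin
      - ⟦ suc (suc (m ℕ.+ n)) ⟧      ≡⟨ cong (λ k → - ⟦ suc k ⟧) (ℕ.+-suc m n) ⟨
      - ⟦ suc m ℕ.+ suc n ⟧          ≈⟨ -‿cong (×′-homo-+ 1# (suc m) (suc n)) ⟩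
      - (⟦ suc m ⟧ + ⟦ suc n ⟧)      ≈⟨ -‿+-comm ⟦ suc m ⟧ ⟦ suc n ⟧ ⟨
      - ⟦ suc m ⟧ + - ⟦ suc n ⟧      ∎
    fromℤ-+ ℤ.-[1+ m ] (ℤ.+ n) = ≈-trans (fromℤ-⊖ n (suc m)) (+-comm ⟦ n ⟧ (- ⟦ suc m ⟧))
    fromℤ-+ (ℤ.+ m) ℤ.-[1+ n ] = fromℤ-⊖ m (suc n)
    fromℤ-+ (ℤ.+ m) (ℤ.+ n) = ×′-homo-+ 1# m n

    fromℤ-neg : ∀ i → fromℤ (ℤ.- i) ≈ - fromℤ i
    fromℤ-neg ℤ.-[1+ n ] = ≈-sym (-‿involutive ⟦ suc n ⟧)
    fromℤ-neg (ℤ.+ zero) = ≈-sym -0#≈0#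
    fromℤ-neg (ℤ.+ suc n) = ≈-refl

    fromℤ-*⁺ : ∀ m n → fromℤ (ℤ.+ m ℤ.* ℤ.+ n) ≈ ⟦ m ⟧ * ⟦ n ⟧
    fromℤ-*⁺ m n = ≈-trans (reflexive (cong fromℤ (sym (ℤ.pos-* m n)))) (×′1-homo-* m n)

    fromℤ-* : ∀ i j → fromℤ (i ℤ.* j) ≈ fromℤ i * fromℤ j
    fromℤ-* (ℤ.+ m) (ℤ.+ n) = fromℤ-*⁺ m n
    fromℤ-* (ℤ.+ m) ℤ.-[1+ n ] = begin
      fromℤ (ℤ.+ m ℤ.* ℤ.- ℤ.+ suc n)    ≡⟨ cong fromℤ (ℤ.neg-distribʳ-* (ℤ.+ m) (ℤ.+ suc n)) ⟨
      fromℤ (ℤ.- (ℤ.+ m ℤ.* ℤ.+ suc n))  ≈⟨ fromℤ-neg (ℤ.+ m ℤ.* ℤ.+ suc n) ⟩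
      - fromℤ (ℤ.+ m ℤ.* ℤ.+ suc n)      ≈⟨ -‿cong (fromℤ-*⁺ m (suc n)) ⟩
      - (⟦ m ⟧ * ⟦ suc n ⟧)              ≈⟨ -‿distribʳ-* ⟦ m ⟧ ⟦ suc n ⟧ ⟩
      ⟦ m ⟧ * - ⟦ suc n ⟧                ∎
    fromℤ-* ℤ.-[1+ m ] (ℤ.+ n) = begin
      fromℤ (ℤ.- ℤ.+ suc m ℤ.* ℤ.+ n)    ≡⟨ cong fromℤ (ℤ.neg-distribˡ-* (ℤ.+ suc m) (ℤ.+ n)) ⟨
      fromℤ (ℤ.- (ℤ.+ suc m ℤ.* ℤ.+ n))  ≈⟨ fromℤ-neg (ℤ.+ suc m ℤ.* ℤ.+ n) ⟩
      - fromℤ (ℤ.+ suc m ℤ.* ℤ.+ n)      ≈⟨ -‿cong (fromℤ-*⁺ (suc m) n) ⟩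
      - (⟦ suc m ⟧ * ⟦ n ⟧)              ≈⟨ -‿distribˡ-* ⟦ suc m ⟧ ⟦ n ⟧ ⟩
      - ⟦ suc m ⟧ * ⟦ n ⟧                ∎
    fromℤ-* ℤ.-[1+ m ] ℤ.-[1+ n ] = begin
      fromℤ (ℤ.+ suc m ℤ.* ℤ.+ suc n)    ≈⟨ fromℤ-*⁺ (suc m) (suc n) ⟩
      ⟦ suc m ⟧ * ⟦ suc n ⟧              ≈⟨ -‿involutive (⟦ suc m ⟧ * ⟦ suc n ⟧) ⟨
      - - (⟦ suc m ⟧ * ⟦ suc n ⟧)        ≈⟨ -‿cong (-‿distribʳ-* ⟦ suc m ⟧ ⟦ suc n ⟧) ⟩
      - (⟦ suc m ⟧ * - ⟦ suc n ⟧)        ≈⟨ -‿distribˡ-* ⟦ suc m ⟧ (- ⟦ suc n ⟧) ⟩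
      - ⟦ suc m ⟧ * - ⟦ suc n ⟧          ∎

  homomorphism : ℤ.+-*-rawRing -Raw-AlmostCommutative⟶ fromCommutativeRing R
  homomorphism = record
    { ⟦_⟧    = fromℤ
    ; +-homo = fromℤ-+
    ; *-homo = fromℤ-*
    ; -‿homo = fromℤ-neg
    ; 0-homo = ≈-refl
    ; 1-homo = ≈-refl
    }

  open Algebra.Solver.Ring ℤ.+-*-rawRing (fromCommutativeRing R) homomorphism
    (λ i j → Maybe.map (λ i≡j → reflexive (cong fromℤ i≡j)) (dec⇒weaklyDec ℤ._≟_ i j)) public
    using (Polynomial; con; _:+_; _:*_; _:-_; :-_; solve; _:=_)

  :0 :1 :2 : ∀ {n} → Polynomial n
  :0 = con (ℤ.+ 0)
  :1 = con (ℤ.+ 1)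
  :2 = con (ℤ.+ 2)

-- Order and arithmetic in the field.

module OrderedField (lem : ExcludedMiddle 0ℓ) (𝓡 : CompleteOrderedField) where

  open CompleteOrderedField 𝓡 public
  open CommutativeRing commutativeRing public
    using (+-assoc; +-comm; +-identityˡ; +-identityʳ; *-assoc; *-comm; *-identityˡ; *-identityʳ; zeroˡ; zeroʳ; distribˡ; distribʳ)
  open IntegerCoefficients commutativeRing public
  open IsTotalOrder isTotalOrder public using ()
    renaming (refl to ≤-refl; trans to ≤-trans; antisym to ≤-antisym; reflexive to ≤-reflexive; total to ≤-total)
  module ≤-Reasoning = Relation.Binary.Reasoning.PartialOrder (TotalOrder.poset totalOrder)
  open Algebra.Properties.Semiring.Mult (CommutativeRing.semiring commutativeRing) public using
      (×1-homo-*; ×-assoc-*; ×-homo-+)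
  open Algebra.Properties.Semiring.Exp (CommutativeRing.semiring commutativeRing) public using (^-homo-*; ^-assocʳ)
  open Algebra.Properties.CommutativeSemiring.Exp (CommutativeRing.commutativeSemiring commutativeRing) public using
      (^-distrib-*)

  abstract
    <⇒≤ : ∀ {x y} → x < y → x ≤ y
    <⇒≤ = proj₁

    ≤-<-trans : ∀ {x y z} → x ≤ y → y < z → x < z
    ≤-<-trans x≤y (y≤z , y≢z) = ≤-trans x≤y y≤z , λ { refl → y≢z (≤-antisym y≤z x≤y) }

    <-≤-trans : ∀ {x y z} → x < y → y ≤ z → x < z
    <-≤-trans (x≤y , x≢y) y≤z = ≤-trans x≤y y≤z , λ { refl → x≢y (≤-antisym x≤y y≤z) }

    <-trans : ∀ {x y z} → x < y → y < z → x < z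
    <-trans x<y y<z = ≤-<-trans (<⇒≤ x<y) y<z

    <⇒≱ : ∀ {x y} → x < y → ¬ (y ≤ x)
    <⇒≱ (x≤y , x≢y) y≤x = x≢y (≤-antisym x≤y y≤x)

    ≰⇒> : ∀ {x y} → ¬ (x ≤ y) → y < x
    ≰⇒> {x} {y} x≰y with ≤-total x y
    ... | inj₁ x≤y = ⊥-elim (x≰y x≤y)
    ... | inj₂ y≤x = y≤x , λ { refl → x≰y ≤-refl }

    -- The side condition is y - x ≡ y′ - x′ without subtraction, a ring identity in every use.
    ≤-by : ∀ {x y x′ y′} → x′ ≤ y′ → y + x′ ≡ x + y′ → x ≤ y
    ≤-by {x} {y} {x′} {y′} x′≤y′ eq = subst₂ _≤_
      (solve 2 (λ a b → :- b :+ (a :+ b) := a) refl x x′)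
      (trans (cong (- x′ +_) (sym eq)) (solve 2 (λ a b → :- b :+ (a :+ b) := a) refl y x′))
      (+-monoʳ-≤ (- x′) (+-monoʳ-≤ x x′≤y′))

    <-by : ∀ {x y x′ y′} → x′ < y′ → y + x′ ≡ x + y′ → x < y
    <-by {x} {y} {x′} {y′} (x′≤y′ , x′≢y′) eq = ≤-by x′≤y′ eq , λ { refl → x′≢y′ (trans
      (solve 2 (λ a b → b := :- a :+ (a :+ b)) refl x x′)
      (trans (cong (- x +_) eq) (solve 2 (λ a b → :- a :+ (a :+ b) := b) refl x y′))) }

    ≡-by : ∀ {x y x′ y′} → x′ ≡ y′ → y + x′ ≡ x + y′ → x ≡ y
    ≡-by x′≡y′ eq = ≤-antisym (≤-by (≤-reflexive x′≡y′) eq) (≤-by (≤-reflexive (sym x′≡y′)) (sym eq))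

    0≤-by : ∀ {x y e} → 0# ≤ e → y ≡ x + e → x ≤ y
    0≤-by {x} {y} 0≤e eq = ≤-by 0≤e (trans (+-identityʳ y) eq)

    0<-by : ∀ {x y e} → 0# < e → y ≡ x + e → x < y
    0<-by {x} {y} 0<e eq = <-by 0<e (trans (+-identityʳ y) eq)

    x≤y⇒0≤y-x : ∀ {x y} → x ≤ y → 0# ≤ y - x
    x≤y⇒0≤y-x {x} {y} x≤y = ≤-by x≤y (solve 2 (λ x y → (y :- x) :+ x := :0 :+ y) refl x y)

    x<y⇒0<y-x : ∀ {x y} → x < y → 0# < y - x
    x<y⇒0<y-x {x} {y} x<y = <-by x<y (solve 2 (λ x y → (y :- x) :+ x := :0 :+ y) refl x y)

    +-mono-≤ : ∀ {a b c d} → a ≤ b → c ≤ d → a + c ≤ b + d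
    +-mono-≤ {a} {b} {c} {d} a≤b c≤d = ≤-trans (+-monoʳ-≤ a c≤d)
      (≤-by a≤b (solve 3 (λ a b d → (b :+ d) :+ a := (a :+ d) :+ b) refl a b d))

    +-mono-<-≤ : ∀ {a b c d} → a < b → c ≤ d → a + c < b + d
    +-mono-<-≤ {a} {b} {c} {d} a<b c≤d = ≤-<-trans (+-monoʳ-≤ a c≤d)
      (<-by a<b (solve 3 (λ a b d → (b :+ d) :+ a := (a :+ d) :+ b) refl a b d))

    0≤+ : ∀ {x y} → 0# ≤ x → 0# ≤ y → 0# ≤ x + y
    0≤+ 0≤x 0≤y = subst (_≤ _) (+-identityʳ 0#) (+-mono-≤ 0≤x 0≤y)

    0<+ : ∀ {x y} → 0# < x → 0# ≤ y → 0# < x + y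
    0<+ 0<x 0≤y = subst (_< _) (+-identityʳ 0#) (+-mono-<-≤ 0<x 0≤y)

    0≤* : ∀ {x y} → 0# ≤ x → 0# ≤ y → 0# ≤ x * y
    0≤* = *-nonNegative

    *-monoˡ-≤ : ∀ {x y} c → 0# ≤ c → x ≤ y → c * x ≤ c * y
    *-monoˡ-≤ {x} {y} c 0≤c x≤y = 0≤-by (0≤* 0≤c (x≤y⇒0≤y-x x≤y))
      (solve 3 (λ x y c → c :* y := c :* x :+ c :* (y :- x)) refl x y c)

    *-monoʳ-≤ : ∀ {x y} c → 0# ≤ c → x ≤ y → x * c ≤ y * c
    *-monoʳ-≤ c 0≤c x≤y = subst₂ _≤_ (*-comm c _) (*-comm c _) (*-monoˡ-≤ c 0≤c x≤y)

    *-mono-≤ : ∀ {a b c d} → 0# ≤ a → a ≤ b → 0# ≤ c → c ≤ d → a * c ≤ b * d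
    *-mono-≤ {a} {b} {c} {d} 0≤a a≤b 0≤c c≤d = ≤-trans (*-monoˡ-≤ a 0≤a c≤d) (*-monoʳ-≤ d (≤-trans 0≤c c≤d) a≤b)

    0≤1 : 0# ≤ 1#
    0≤1 with ≤-total 0# 1#
    ... | inj₁ 0≤1 = 0≤1
    ... | inj₂ 1≤0 = subst (0# ≤_) (solve 0 ((:0 :- :1) :* (:0 :- :1) := :1) refl)
              (0≤* (x≤y⇒0≤y-x 1≤0) (x≤y⇒0≤y-x 1≤0))

    0<1 : 0# < 1#
    0<1 = 0≤1 , 0≢1

    0<2 : 0# < 2#
    0<2 = 0<+ 0<1 0≤1

    1≤2 : 1# ≤ 2#
    1≤2 = 0≤-by 0≤1 refl

    >⇒≢ : ∀ {x} → 0# < x → x ≢ 0#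
    >⇒≢ (_ , 0≢x) x≡0 = 0≢x (sym x≡0)

    ⁻¹-inverseˡ : ∀ {x} → 0# < x → x ⁻¹ * x ≡ 1#
    ⁻¹-inverseˡ {x} 0<x = trans (*-comm (x ⁻¹) x) (⁻¹-inverseʳ x (>⇒≢ 0<x))

    *-cancelˡ-≡ : ∀ {x y} c → 0# < c → c * x ≡ c * y → x ≡ y
    *-cancelˡ-≡ {x} {y} c 0<c eq = trans (lemma x) (trans (cong (c ⁻¹ *_) eq) (sym (lemma y)))
      where
      lemma : ∀ z → z ≡ c ⁻¹ * (c * z)
      lemma z = trans (sym (*-identityˡ z)) (trans (cong (_* z) (sym (⁻¹-inverseˡ 0<c))) (*-assoc (c ⁻¹) c z))

    0<* : ∀ {x y} → 0# < x → 0# < y → 0# < x * y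
    0<* {x} {y} 0<x 0<y = 0≤* (<⇒≤ 0<x) (<⇒≤ 0<y) ,
      λ 0≡xy → proj₂ 0<y (*-cancelˡ-≡ x 0<x (trans (zeroʳ x) 0≡xy))

    *-monoˡ-< : ∀ {x y} c → 0# < c → x < y → c * x < c * y
    *-monoˡ-< {x} {y} c 0<c x<y = 0<-by (0<* 0<c (x<y⇒0<y-x x<y))
      (solve 3 (λ x y c → c :* y := c :* x :+ c :* (y :- x)) refl x y c)

    *-cancelˡ-≤ : ∀ {x y} c → 0# < c → c * x ≤ c * y → x ≤ y
    *-cancelˡ-≤ {x} {y} c 0<c cx≤cy with ≤-total x y
    ... | inj₁ x≤y = x≤y
    ... | inj₂ y≤x = ≤-reflexive (*-cancelˡ-≡ c 0<c (≤-antisym cx≤cy (*-monoˡ-≤ c (<⇒≤ 0<c) y≤x)))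

    *-cancelˡ-< : ∀ {x y} c → 0# ≤ c → c * x < c * y → x < y
    *-cancelˡ-< c 0≤c cx<cy = ≰⇒> λ y≤x → <⇒≱ cx<cy (*-monoˡ-≤ c 0≤c y≤x)

    0<⁻¹ : ∀ {x} → 0# < x → 0# < x ⁻¹
    0<⁻¹ {x} 0<x = *-cancelˡ-< x (<⇒≤ 0<x) (subst₂ _<_ (sym (zeroʳ x)) (sym (⁻¹-inverseʳ x (>⇒≢ 0<x))) 0<1)

    *-/-cancel : ∀ {x} y → 0# < y → y * (x / y) ≡ x
    *-/-cancel {x} y 0<y = trans (solve 3 (λ x y z → y :* (x :* z) := x :* (y :* z)) refl x y (y ⁻¹))
      (trans (cong (x *_) (⁻¹-inverseʳ y (>⇒≢ 0<y))) (*-identityʳ x))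

    0≤/ : ∀ {x y} → 0# ≤ x → 0# < y → 0# ≤ x / y
    0≤/ 0≤x 0<y = 0≤* 0≤x (<⇒≤ (0<⁻¹ 0<y))

    0</ : ∀ {x y} → 0# < x → 0# < y → 0# < x / y
    0</ 0<x 0<y = 0<* 0<x (0<⁻¹ 0<y)

  -- Natural numbers in the field and the Archimedean property.

  ι : ℕ → ℝ
  ι n = n ×ℕ 1#

  abstract
    ι-+ : ∀ m n → ι (m ℕ.+ n) ≡ ι m + ι n
    ι-+ = ×-homo-+ 1#

    ι-* : ∀ m n → ι (m ℕ.* n) ≡ ι m * ι n
    ι-* = ×1-homo-*

    ×ℕ≡ι* : ∀ n x → n ×ℕ x ≡ ι n * x
    ×ℕ≡ι* n x = trans (cong (n ×ℕ_) (sym (*-identityˡ x))) (sym (×-assoc-* n 1# x))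

    0≤ι : ∀ n → 0# ≤ ι n
    0≤ι zero = ≤-refl
    0≤ι (suc n) = 0≤+ 0≤1 (0≤ι n)

    0<ι : ∀ n → 0# < ι (suc n)
    0<ι n = 0<+ 0<1 (0≤ι n)

    ι-mono : ∀ {m n} → m ℕ.≤ n → ι m ≤ ι n
    ι-mono {n = n} z≤n = 0≤ι n
    ι-mono (s≤s m≤n) = +-monoʳ-≤ 1# (ι-mono m≤n)

  abstract
    archimedean : ∀ x → ∃ λ n → x ≤ ι n
    archimedean x with lem {P = ∃ λ n → x ≤ ι n}
    ... | yes bounded = bounded
    ... | no unbounded with complete (λ y → ∃ λ n → y ≡ ι n) (0# , 0 , refl)
              (x , λ { _ (n , refl) → <⇒≤ (≰⇒> λ x≤n → unbounded (n , x≤n)) })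
    -- Every n + 1 is at most s, so `s - 1#` bounds the natural numbers as well, against the
    -- minimality of s.
    ...   | s , upper , least = ⊥-elim (<⇒≱ (0<-by 0<1 (solve 1 (λ s → s := (s :- :1) :+ :1) refl s))
              (least (s - 1#) λ { _ (n , refl) → ≤-by (upper (1# + ι n) (suc n , refl))
                (solve 2 (λ s n → (s :- :1) :+ (:1 :+ n) := n :+ s) refl s (ι n)) }))

    -- Dividing the hypothesis by suc n makes the error c / suc n vanish in the limit.
    ≤-by-scaling : ∀ {x y} c → (∀ n → ι (suc n) * x ≤ ι (suc n) * y + c) → x ≤ y
    ≤-by-scaling {x} {y} c h with lem {P = x ≤ y}
    ... | yes x≤y = x≤y
    ... | no x≰y with x<y⇒0<y-x (≰⇒> x≰y)
    ...   | 0<δ with archimedean (c / (x - y))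
    -- The first n copies of x - y already reach c, so `suc n` copies exceed it.
    ...     | n , c/δ≤n = ⊥-elim (<⇒≱
                (0<-by 0<δ (solve 3 (λ n x y → (:1 :+ n) :* x := ((:1 :+ n) :* y :+ (x :- y) :* n) :+ (x :- y))
                    refl (ι n) x y))
                (≤-trans (h n) (+-monoʳ-≤ (ι (suc n) * y)
                  (≤-trans (≤-reflexive (sym (*-/-cancel (x - y) 0<δ))) (*-monoˡ-≤ (x - y) (<⇒≤ 0<δ) c/δ≤n)))))

    floor : ∀ x → 0# ≤ x → ∃ λ n → ι n ≤ x × x ≤ ι (suc n)
    floor x 0≤x with archimedean x
    ... | n , x≤n = search n x≤n
      where
      search : ∀ n → x ≤ ι n → ∃ λ n → ι n ≤ x × x ≤ ι (suc n)
      search zero x≤0 = 0 , 0≤x , ≤-trans x≤0 (0≤ι 1)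
      search (suc n) x≤1+n with ≤-total x (ι n)
      ... | inj₁ x≤n = search n x≤n
      ... | inj₂ n≤x = n , n≤x , x≤1+n

  -- Integer powers.

  abstract
    0≤^ℕ : ∀ {x} n → 0# ≤ x → 0# ≤ x ^ℕ n
    0≤^ℕ zero 0≤x = 0≤1
    0≤^ℕ (suc n) 0≤x = 0≤* 0≤x (0≤^ℕ n 0≤x)

    0<^ℕ : ∀ {x} n → 0# < x → 0# < x ^ℕ n
    0<^ℕ zero 0<x = 0<1
    0<^ℕ (suc n) 0<x = 0<* 0<x (0<^ℕ n 0<x)

    1≤^ℕ : ∀ {x} n → 1# ≤ x → 1# ≤ x ^ℕ n
    1≤^ℕ zero 1≤x = ≤-refl
    1≤^ℕ {x} (suc n) 1≤x = subst (_≤ x * x ^ℕ n) (*-identityʳ 1#) (*-mono-≤ 0≤1 1≤x 0≤1 (1≤^ℕ n 1≤x))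

    ^ℕ-≤1 : ∀ {x} n → 0# ≤ x → x ≤ 1# → x ^ℕ n ≤ 1#
    ^ℕ-≤1 zero 0≤x x≤1 = ≤-refl
    ^ℕ-≤1 {x} (suc n) 0≤x x≤1 = subst (x * x ^ℕ n ≤_) (*-identityʳ 1#)
        (*-mono-≤ 0≤x x≤1 (0≤^ℕ n 0≤x) (^ℕ-≤1 n 0≤x x≤1))

    ^ℕ-monoˡ : ∀ {x y} n → 0# ≤ x → x ≤ y → x ^ℕ n ≤ y ^ℕ n
    ^ℕ-monoˡ zero 0≤x x≤y = ≤-refl
    ^ℕ-monoˡ (suc n) 0≤x x≤y = *-mono-≤ 0≤x x≤y (0≤^ℕ n 0≤x) (^ℕ-monoˡ n 0≤x x≤y)

    ^ℕ-monoʳ : ∀ {x m n} → 1# ≤ x → m ℕ.≤ n → x ^ℕ m ≤ x ^ℕ n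
    ^ℕ-monoʳ {n = n} 1≤x z≤n = 1≤^ℕ n 1≤x
    ^ℕ-monoʳ 1≤x (s≤s m≤n) = *-monoˡ-≤ _ (≤-trans 0≤1 1≤x) (^ℕ-monoʳ 1≤x m≤n)

    1+n*x≤[1+x]^n : ∀ n {x} → 0# ≤ x → 1# + ι n * x ≤ (1# + x) ^ℕ n
    1+n*x≤[1+x]^n zero {x} 0≤x = ≤-reflexive (solve 1 (λ x → :1 :+ :0 :* x := :1) refl x)
    1+n*x≤[1+x]^n (suc n) {x} 0≤x = ≤-trans
      (0≤-by (0≤* (0≤* (0≤ι n) 0≤x) 0≤x)
        (solve 2 (λ n x → (:1 :+ x) :* (:1 :+ n :* x) := (:1 :+ (:1 :+ n) :* x) :+ n :* x :* x) refl (ι n) x))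
      (*-monoˡ-≤ (1# + x) (0≤+ 0≤1 0≤x) (1+n*x≤[1+x]^n n 0≤x))

    -- The integer case of Bernoulli's inequality: (u ^ m - 1) / m is increasing in m.
    m*[uⁿ-1]≤n*[uᵐ-1] : ∀ {u} m n → 0# ≤ u → n ℕ.≤ m → ι m * (u ^ℕ n - 1#) ≤ ι n * (u ^ℕ m - 1#)
    m*[uⁿ-1]≤n*[uᵐ-1] {u} m n 0≤u n≤m = go (ℕ.≤⇒≤′ n≤m)
      where
      -- For u ≤ 1 the powers decrease, but the factor u - 1 is then nonpositive, so the product is
      -- nondecreasing in the exponent in both cases.
      [u-1]uⁿ≤[u-1]uᵐ : ∀ {m n} → n ℕ.≤ m → (u - 1#) * u ^ℕ n ≤ (u - 1#) * u ^ℕ m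
      [u-1]uⁿ≤[u-1]uᵐ {m} {n} n≤m with ≤-total 1# u
      ... | inj₁ 1≤u = *-monoˡ-≤ (u - 1#) (x≤y⇒0≤y-x 1≤u) (^ℕ-monoʳ 1≤u n≤m)
      ... | inj₂ u≤1 = ≤-by (*-monoˡ-≤ (1# - u) (x≤y⇒0≤y-x u≤1) (decreasing n≤m))
              (solve 3 (λ u a b → (u :- :1) :* b :+ (:1 :- u) :* b := (u :- :1) :* a :+ (:1 :- u) :* a)
                  refl u (u ^ℕ n) (u ^ℕ m))
        where
        decreasing : ∀ {m n} → n ℕ.≤ m → u ^ℕ m ≤ u ^ℕ n
        decreasing {m} z≤n = ^ℕ-≤1 m 0≤u u≤1
        decreasing (s≤s n≤m) = *-monoˡ-≤ u 0≤u (decreasing n≤m)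
      -- u^n - 1 is the sum of (u - 1) u^j over j < n, and each of these terms is at most (u - 1)
      -- u^m.
      geometric : ∀ {m n} → n ℕ.≤ m → u ^ℕ n - 1# ≤ ι n * ((u - 1#) * u ^ℕ m)
      geometric {m} {zero} _ = ≤-reflexive (solve 2 (λ u a → :1 :- :1 := :0 :* ((u :- :1) :* a)) refl u (u ^ℕ m))
      geometric {m} {suc n} n<m = ≤-by (+-mono-≤ ([u-1]uⁿ≤[u-1]uᵐ (ℕ.<⇒≤ n<m)) (geometric (ℕ.<⇒≤ n<m)))
        (solve 4 (λ u a b n → (:1 :+ n) :* ((u :- :1) :* b) :+ ((u :- :1) :* a :+ (a :- :1))
            := (u :* a :- :1) :+ ((u :- :1) :* b :+ n :* ((u :- :1) :* b)))
          refl u (u ^ℕ n) (u ^ℕ m) (ι n))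
      go : ∀ {m} → n ℕ.≤′ m → ι m * (u ^ℕ n - 1#) ≤ ι n * (u ^ℕ m - 1#)
      go (ℕ.≤′-reflexive refl) = ≤-refl
      go (ℕ.≤′-step {m} n≤′m) = ≤-by (+-mono-≤ (go n≤′m) (geometric (ℕ.≤′⇒≤ n≤′m)))
        (solve 5 (λ u a b n m → n :* (u :* b :- :1) :+ (m :* (a :- :1) :+ (a :- :1))
            := (:1 :+ m) :* (a :- :1) :+ (n :* (b :- :1) :+ n :* ((u :- :1) :* b)))
          refl u (u ^ℕ n) (u ^ℕ m) (ι n) (ι m))

-- The binary logarithm.

module Logarithm (lem : ExcludedMiddle 0ℓ) (𝓡 : CompleteOrderedField) where

  open OrderedField lem 𝓡

  2^_ : ℕ → ℝ
  2^ n = 2# ^ℕ n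

  0<2^ : ∀ n → 0# < 2^ n
  0<2^ n = 0<^ℕ n 0<2

  ι≤2^ : ∀ n → ι n ≤ 2^ n
  ι≤2^ n = ≤-trans (0≤-by 0≤1 (solve 1 (λ n → :1 :+ n :* :1 := n :+ :1) refl (ι n))) (1+n*x≤[1+x]^n n 0≤1)

  2^-cancel-≤ : ∀ {m n} → 2^ m ≤ 2^ n → m ℕ.≤ n
  2^-cancel-≤ {m} {n} 2^m≤2^n with ℕ.≤-<-connex m n
  ... | inj₁ m≤n = m≤n
  ... | inj₂ n<m = ⊥-elim (<⇒≱ (0<-by (0<2^ n) (solve 1 (λ x → :2 :* x := x :+ x) refl (2^ n)))
          (≤-trans (^ℕ-monoʳ {m = suc n} {n = m} 1≤2 n<m) 2^m≤2^n))

  abstract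
    -- The factor `2^ b` lifts y to at least 1, so natural exponents suffice and a - b serves as the
    -- integer part of the logarithm. Applied to y = x^n, this locates log₂ x within 1/n.
    dyadic-bracket : ∀ {y} → 0# < y → ∃ λ a → ∃ λ b → 2^ a ≤ 2^ b * y × 2^ b * y ≤ 2^ (suc a)
    dyadic-bracket {y} 0<y with archimedean (y ⁻¹)
    ... | b , y⁻¹≤b with archimedean (2^ b * y)
    ...   | N , z≤N with search N (≤-trans z≤N (ι≤2^ N))
      where
      1≤z : 1# ≤ 2^ b * y
      1≤z = ≤-trans (≤-reflexive (sym (⁻¹-inverseˡ 0<y))) (*-monoʳ-≤ y (<⇒≤ 0<y) (≤-trans y⁻¹≤b (ι≤2^ b)))
      search : ∀ n → 2^ b * y ≤ 2^ n → ∃ λ a → 2^ a ≤ 2^ b * y × 2^ b * y ≤ 2^ (suc a)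
      search zero z≤1 = 0 , 1≤z , ≤-trans z≤1 (^ℕ-monoʳ {m = 0} {n = 1} 1≤2 z≤n)
      search (suc n) z≤2^1+n with ≤-total (2^ b * y) (2^ n)
      ... | inj₁ z≤2^n = search n z≤2^n
      ... | inj₂ 2^n≤z = n , 2^n≤z , z≤2^1+n
    ...     | a , lower , upper = a , b , lower , upper

  -- s = (a - b) / (k + 1) is a dyadic lower bound of log₂ x.
  BelowLog : ℝ → ℝ → Set
  BelowLog x s = ∃ λ k → ∃ λ a → ∃ λ b → ι (suc k) * s + ι b ≡ ι a × 2^ a ≤ 2^ b * x ^ℕ suc k

  -- Raising the lower bound to the power n and the upper bound to the power n′ gives both the
  -- factor x^(n n′). Once it is eliminated, only powers of 2 are compared, and their exponents can
  -- be read off.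
  BelowLog-upper : ∀ {x s} k a b → 0# < x → 2^ b * x ^ℕ suc k ≤ 2^ a → BelowLog x s → ι b + ι (suc k) * s ≤ ι a
  BelowLog-upper {x} {s} k a b 0<x upper (k′ , a′ , b′ , eq , lower) = *-cancelˡ-≤ (ι n′) (0<ι k′)
      (≤-by exponents (begin
      ι n′ * ι a + ι (a′ ℕ.* n ℕ.+ b ℕ.* n′)
        ≡⟨ cong (ι n′ * ι a +_) (expand a′ n b n′) ⟩
      ι n′ * ι a + (ι a′ * ι n + ι b * ι n′)
        ≡⟨ cong (λ z → ι n′ * ι a + (z * ι n + ι b * ι n′)) (sym eq) ⟩
      ι n′ * ι a + ((ι n′ * s + ι b′) * ι n + ι b * ι n′)
        ≡⟨ solve 6 (λ n n′ a b b′ s → n′ :* a :+ ((n′ :* s :+ b′) :* n :+ b :* n′)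
            := n′ :* (b :+ n :* s) :+ (b′ :* n :+ a :* n′))
             refl (ι n) (ι n′) (ι a) (ι b) (ι b′) s ⟩
      ι n′ * (ι b + ι n * s) + (ι b′ * ι n + ι a * ι n′)
        ≡⟨ cong (ι n′ * (ι b + ι n * s) +_) (sym (expand b′ n a n′)) ⟩
      ι n′ * (ι b + ι n * s) + ι (b′ ℕ.* n ℕ.+ a ℕ.* n′) ∎))
    where
    open ≡-Reasoning
    n = suc k
    n′ = suc k′
    expand : ∀ a m b n → ι (a ℕ.* m ℕ.+ b ℕ.* n) ≡ ι a * ι m + ι b * ι n
    expand a m b n = trans (ι-+ (a ℕ.* m) (b ℕ.* n)) (cong₂ _+_ (ι-* a m) (ι-* b n))
    power : ∀ a m b n → 2^ (a ℕ.* m ℕ.+ b ℕ.* n) ≡ (2^ a) ^ℕ m * (2^ b) ^ℕ n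
    power a m b n = trans (^-homo-* 2# (a ℕ.* m) (b ℕ.* n)) (sym (cong₂ _*_ (^-assocʳ 2# a m) (^-assocʳ 2# b n)))
    exponents : ι (a′ ℕ.* n ℕ.+ b ℕ.* n′) ≤ ι (b′ ℕ.* n ℕ.+ a ℕ.* n′)
    exponents = ι-mono (2^-cancel-≤ {a′ ℕ.* n ℕ.+ b ℕ.* n′} {b′ ℕ.* n ℕ.+ a ℕ.* n′}
        (subst₂ _≤_ (sym (power a′ n b n′)) (sym (power b′ n a n′)) (≤-trans
      (*-monoʳ-≤ _ (0≤^ℕ n′ (<⇒≤ (0<2^ b))) (^ℕ-monoˡ n (<⇒≤ (0<2^ a′)) lower))
      (≤-trans (≤-reflexive rearrange)
        (*-monoˡ-≤ _ (0≤^ℕ n (<⇒≤ (0<2^ b′))) (^ℕ-monoˡ n′ (0≤* (<⇒≤ (0<2^ b)) (0≤^ℕ n (<⇒≤ 0<x))) upper))))))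
      where
      rearrange : (2^ b′ * x ^ℕ n′) ^ℕ n * (2^ b) ^ℕ n′ ≡ (2^ b′) ^ℕ n * (2^ b * x ^ℕ n) ^ℕ n′
      rearrange = begin
        (2^ b′ * x ^ℕ n′) ^ℕ n * (2^ b) ^ℕ n′
          ≡⟨ cong (_* (2^ b) ^ℕ n′) (^-distrib-* (2^ b′) (x ^ℕ n′) n) ⟩
        ((2^ b′) ^ℕ n * (x ^ℕ n′) ^ℕ n) * (2^ b) ^ℕ n′
          ≡⟨ cong (λ z → ((2^ b′) ^ℕ n * z) * (2^ b) ^ℕ n′)
               (trans (^-assocʳ x n′ n) (trans (cong (x ^ℕ_) (ℕ.*-comm n′ n)) (sym (^-assocʳ x n n′)))) ⟩
        ((2^ b′) ^ℕ n * (x ^ℕ n) ^ℕ n′) * (2^ b) ^ℕ n′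
          ≡⟨ solve 3 (λ p q r → (p :* q) :* r := p :* (r :* q)) refl ((2^ b′) ^ℕ n) ((x ^ℕ n) ^ℕ n′) ((2^ b) ^ℕ n′) ⟩
        (2^ b′) ^ℕ n * ((2^ b) ^ℕ n′ * (x ^ℕ n) ^ℕ n′)
          ≡⟨ cong ((2^ b′) ^ℕ n *_) (sym (^-distrib-* (2^ b) (x ^ℕ n) n′)) ⟩
        (2^ b′) ^ℕ n * (2^ b * x ^ℕ n) ^ℕ n′ ∎

  BelowLog-quotient : ∀ {x} k a b → 2^ a ≤ 2^ b * x ^ℕ suc k → BelowLog x ((ι a - ι b) / ι (suc k))
  BelowLog-quotient k a b lower = k , a , b ,
    trans (cong (_+ ι b) (*-/-cancel (ι (suc k)) (0<ι k))) (solve 2 (λ a b → (a :- b) :+ b := a) refl (ι a) (ι b)) ,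
        lower

  log₂-exists : ∀ {x} → 0# < x → ∃ λ l → (∀ s → BelowLog x s → s ≤ l) × (∀ u → (∀ s → BelowLog x s → s ≤ u) → l ≤ u)
  log₂-exists {x} 0<x with dyadic-bracket (0<^ℕ 1 0<x)
  ... | a , b , lower , upper = complete (BelowLog x) (_ , BelowLog-quotient 0 a b lower)
            (ι (suc a) - ι b , λ s below →
          ≤-by (BelowLog-upper 0 (suc a) b 0<x upper below)
            (solve 3 (λ a b s → (a :- b) :+ (b :+ (:1 :+ :0) :* s) := s :+ a) refl (ι (suc a)) (ι b) s))

  abstract
    -- log₂ of a nonpositive number is the junk value 0.
    log₂ : ℝ → ℝ
    log₂ x with lem {P = 0# < x}
    ... | yes 0<x = proj₁ (log₂-exists 0<x)
    ... | no _ = 0#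

    log₂-upper : ∀ {x s} → 0# < x → BelowLog x s → s ≤ log₂ x
    log₂-upper {x} {s} 0<x below with lem {P = 0# < x}
    ... | yes 0<x = proj₁ (proj₂ (log₂-exists 0<x)) s below
    ... | no ¬0<x = ⊥-elim (¬0<x 0<x)

    log₂-least : ∀ {x u} → 0# < x → (∀ s → BelowLog x s → s ≤ u) → log₂ x ≤ u
    log₂-least {x} {u} 0<x ub with lem {P = 0# < x}
    ... | yes 0<x = proj₂ (proj₂ (log₂-exists 0<x)) u ub
    ... | no ¬0<x = ⊥-elim (¬0<x 0<x)

  2^≤⇒≤log₂ : ∀ {x} k a b → 0# < x → 2^ a ≤ 2^ b * x ^ℕ suc k → ι a ≤ ι b + ι (suc k) * log₂ x
  2^≤⇒≤log₂ {x} k a b 0<x lower = ≤-by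
    (*-monoˡ-≤ (ι (suc k)) (0≤ι (suc k)) (log₂-upper 0<x (BelowLog-quotient k a b lower)))
    (trans (cong (ι b + ι (suc k) * log₂ x +_) (*-/-cancel (ι (suc k)) (0<ι k)))
      (solve 3 (λ a b l → (b :+ l) :+ (a :- b) := a :+ l) refl (ι a) (ι b) (ι (suc k) * log₂ x)))

  -- `log₂` is a supremum of lower bounds, so an upper estimate must hold for each of them;
  -- `BelowLog-upper` supplies that.
  ≤2^⇒log₂≤ : ∀ {x} k a b → 0# < x → 2^ b * x ^ℕ suc k ≤ 2^ a → ι b + ι (suc k) * log₂ x ≤ ι a
  ≤2^⇒log₂≤ {x} k a b 0<x upper = ≤-by
    (*-monoˡ-≤ (ι (suc k)) (0≤ι (suc k)) (log₂-least {u = (ι a - ι b) / ι (suc k)} 0<x λ s below →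
      *-cancelˡ-≤ (ι (suc k)) (0<ι k) (≤-trans (≤-by (BelowLog-upper k a b 0<x upper below)
        (solve 3 (λ a b s → (a :- b) :+ (b :+ s) := s :+ a) refl (ι a) (ι b) (ι (suc k) * s)))
        (≤-reflexive (sym (*-/-cancel (ι (suc k)) (0<ι k)))))))
    (trans (solve 3 (λ a b l → a :+ l := (b :+ l) :+ (a :- b)) refl (ι a) (ι b) (ι (suc k) * log₂ x))
      (cong (ι b + ι (suc k) * log₂ x +_) (sym (*-/-cancel (ι (suc k)) (0<ι k)))))

  -- Both sides are within 2 / n of each other, for every n.
  log₂-* : ∀ {x y} → 0# < x → 0# < y → log₂ (x * y) ≡ log₂ x + log₂ y
  log₂-* {x} {y} 0<x 0<y = ≤-antisym
      (≤-by-scaling 2# λ k → proj₁ (bounds k))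
      (≤-by-scaling 2# λ k → proj₂ (bounds k))
    where
    0<xy = 0<* 0<x 0<y
    bounds : ∀ k → ι (suc k) * log₂ (x * y) ≤ ι (suc k) * (log₂ x + log₂ y) + 2# ×
                   ι (suc k) * (log₂ x + log₂ y) ≤ ι (suc k) * log₂ (x * y) + 2#
    -- Both brackets use the same exponent n and have width 1 on the logarithmic scale. Their
    -- product is a bracket of width 2 for x * y, which is the error term `2#`.
    bounds k with dyadic-bracket (0<^ℕ (suc k) 0<x) | dyadic-bracket (0<^ℕ (suc k) 0<y)
    ... | a , b , lx , ux | a′ , b′ , ly , uy =
        ≤-by (+-mono-≤ xy-upper (≤-trans (+-mono-≤ x-lower y-lower) (≤-reflexive regroup)))
          (solve 4 (λ S T XY Z → (Z :+ :2) :+ ((T :+ XY) :+ S) := XY :+ ((:2 :+ S) :+ (T :+ Z))) refl S T XY Z) ,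
        ≤-by (+-mono-≤ xy-lower (≤-trans (≤-reflexive (sym regroup))
            (≤-trans (+-mono-≤ x-upper y-upper) (≤-reflexive regroup′))))
          (solve 4 (λ S T XY Z → (XY :+ :2) :+ (S :+ (T :+ Z)) := Z :+ ((T :+ XY) :+ (:2 :+ S))) refl S T XY Z)
      where
      n = suc k
      product : (2^ b * x ^ℕ n) * (2^ b′ * y ^ℕ n) ≡ 2^ (b ℕ.+ b′) * (x * y) ^ℕ n
      product = trans (solve 4 (λ p q r s → (p :* q) :* (r :* s) := (p :* r) :* (q :* s))
          refl (2^ b) (x ^ℕ n) (2^ b′) (y ^ℕ n))
        (sym (cong₂ _*_ (^-homo-* 2# b b′) (^-distrib-* x y n)))
      combine-upper : 2^ (b ℕ.+ b′) * (x * y) ^ℕ n ≤ 2^ (suc a ℕ.+ suc a′)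
      combine-upper = subst₂ _≤_ product (sym (^-homo-* 2# (suc a) (suc a′)))
        (*-mono-≤ (0≤* (<⇒≤ (0<2^ b)) (0≤^ℕ n (<⇒≤ 0<x))) ux (0≤* (<⇒≤ (0<2^ b′)) (0≤^ℕ n (<⇒≤ 0<y))) uy)
      combine-lower : 2^ (a ℕ.+ a′) ≤ 2^ (b ℕ.+ b′) * (x * y) ^ℕ n
      combine-lower = subst₂ _≤_ (sym (^-homo-* 2# a a′)) product
        (*-mono-≤ (<⇒≤ (0<2^ a)) lx (<⇒≤ (0<2^ a′)) ly)
      S = ι a + ι a′
      T = ι b + ι b′
      XY = ι n * log₂ (x * y)
      Z = ι n * (log₂ x + log₂ y)
      regroup : (ι b + ι n * log₂ x) + (ι b′ + ι n * log₂ y) ≡ T + Z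
      regroup = solve 5 (λ b b′ n X Y → (b :+ n :* X) :+ (b′ :+ n :* Y) := (b :+ b′) :+ n :* (X :+ Y))
        refl (ι b) (ι b′) (ι n) (log₂ x) (log₂ y)
      regroup′ : ι (suc a) + ι (suc a′) ≡ 2# + S
      regroup′ = solve 2 (λ a a′ → (:1 :+ a) :+ (:1 :+ a′) := :2 :+ (a :+ a′)) refl (ι a) (ι a′)
      xy-upper : T + XY ≤ 2# + S
      xy-upper = subst₂ (λ p q → p + XY ≤ q) (ι-+ b b′) (trans (ι-+ (suc a) (suc a′)) regroup′)
        (≤2^⇒log₂≤ k (suc a ℕ.+ suc a′) (b ℕ.+ b′) 0<xy combine-upper)
      xy-lower : S ≤ T + XY
      xy-lower = subst₂ (λ p q → q ≤ p + XY) (ι-+ b b′) (ι-+ a a′)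
        (2^≤⇒≤log₂ k (a ℕ.+ a′) (b ℕ.+ b′) 0<xy combine-lower)
      x-lower = 2^≤⇒≤log₂ k a b 0<x lx
      y-lower = 2^≤⇒≤log₂ k a′ b′ 0<y ly
      x-upper = ≤2^⇒log₂≤ k (suc a) b 0<x ux
      y-upper = ≤2^⇒log₂≤ k (suc a′) b′ 0<y uy

-- Monotonicity of the logarithm and its inverse.

module Exponential (lem : ExcludedMiddle 0ℓ) (𝓡 : CompleteOrderedField) where

  open OrderedField lem 𝓡
  open Logarithm lem 𝓡

  abstract
    -- By Bernoulli's inequality z^n ≥ 1 + n (z - 1), which reaches 2 once n ≥ 1/(z - 1); then n
    -- log₂ z ≥ 1.
    1<⇒0<log₂ : ∀ {z} → 1# < z → 0# < log₂ z
    1<⇒0<log₂ {z} 1<z with archimedean ((z - 1#) ⁻¹)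
    ... | n , e⁻¹≤n = *-cancelˡ-< (ι (suc n)) (0≤ι (suc n))
          (<-≤-trans (subst (_< ι 1) (sym (zeroʳ (ι (suc n)))) (0<ι 0))
            (subst (ι 1 ≤_) (+-identityˡ _) (2^≤⇒≤log₂ n 1 0 (<-trans 0<1 1<z) z^n≥2)))
      where
      0<e : 0# < z - 1#
      0<e = x<y⇒0<y-x 1<z
      z^n≥2 : 2^ 1 ≤ 2^ 0 * z ^ℕ suc n
      z^n≥2 = begin
        2# * 1#                         ≈⟨ solve 0 (:2 :* :1 := :1 :+ :1) refl ⟩
        1# + 1#                         ≈⟨ cong (1# +_) (sym (⁻¹-inverseˡ 0<e)) ⟩
        1# + (z - 1#) ⁻¹ * (z - 1#)     ≤⟨ +-monoʳ-≤ 1#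
            (*-monoʳ-≤ (z - 1#) (<⇒≤ 0<e) (≤-trans e⁻¹≤n (0≤-by 0≤1 (+-comm 1# (ι n))))) ⟩
        1# + ι (suc n) * (z - 1#)       ≤⟨ 1+n*x≤[1+x]^n (suc n) (<⇒≤ 0<e) ⟩
        (1# + (z - 1#)) ^ℕ suc n        ≈⟨ cong (_^ℕ suc n) (solve 1 (λ z → :1 :+ (z :- :1) := z) refl z) ⟩
        z ^ℕ suc n                      ≈⟨ *-identityˡ _ ⟨
        1# * z ^ℕ suc n                 ∎
        where open ≤-Reasoning

    log₂-mono-< : ∀ {x y} → 0# < x → x < y → log₂ x < log₂ y
    log₂-mono-< {x} {y} 0<x x<y = subst (log₂ x <_) (trans (sym (log₂-* 0<x 0<z)) (cong log₂ (*-/-cancel x 0<x)))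
        (0<-by (1<⇒0<log₂ 1<z) refl)
      where
      1<z : 1# < y / x
      1<z = *-cancelˡ-< x (<⇒≤ 0<x) (subst₂ _<_ (sym (*-identityʳ x)) (sym (*-/-cancel x 0<x)) x<y)
      0<z : 0# < y / x
      0<z = <-trans 0<1 1<z

    log₂-cancel-≤ : ∀ {x y} → 0# < y → log₂ x ≤ log₂ y → x ≤ y
    log₂-cancel-≤ {x} {y} 0<y logx≤logy with lem {P = x ≤ y}
    ... | yes x≤y = x≤y
    ... | no x≰y = ⊥-elim (<⇒≱ (log₂-mono-< 0<y (≰⇒> x≰y)) logx≤logy)

    log₂-injective : ∀ {x y} → 0# < x → 0# < y → log₂ x ≡ log₂ y → x ≡ y
    log₂-injective 0<x 0<y eq = ≤-antisym (log₂-cancel-≤ 0<y (≤-reflexive eq))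
        (log₂-cancel-≤ 0<x (≤-reflexive (sym eq)))

    log₂-mono-≤ : ∀ {x y} → 0# < x → x ≤ y → log₂ x ≤ log₂ y
    log₂-mono-≤ {x} {y} 0<x x≤y with lem {P = x ≡ y}
    ... | yes refl = ≤-refl
    ... | no x≢y = <⇒≤ (log₂-mono-< 0<x (x≤y , x≢y))

    log₂-1 : log₂ 1# ≡ 0#
    log₂-1 = ≡-by (sym (trans (cong log₂ (sym (*-identityʳ 1#))) (log₂-* 0<1 0<1)))
      (solve 1 (λ l → :0 :+ (l :+ l) := l :+ l) refl (log₂ 1#))

    log₂-^ℕ : ∀ {x} n → 0# < x → log₂ (x ^ℕ n) ≡ ι n * log₂ x
    log₂-^ℕ {x} zero 0<x = trans log₂-1 (sym (zeroˡ (log₂ x)))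
    log₂-^ℕ {x} (suc n) 0<x = trans (log₂-* 0<x (0<^ℕ n 0<x)) (trans (cong (log₂ x +_) (log₂-^ℕ n 0<x))
      (solve 2 (λ n l → l :+ n :* l := (:1 :+ n) :* l) refl (ι n) (log₂ x)))

    log₂-⁻¹ : ∀ {x} → 0# < x → log₂ (x ⁻¹) ≡ - log₂ x
    log₂-⁻¹ {x} 0<x = ≡-by (trans (sym (log₂-* 0<x (0<⁻¹ 0<x))) (trans (cong log₂ (⁻¹-inverseʳ x (>⇒≢ 0<x))) log₂-1))
      (solve 2 (λ l k → :- l :+ (l :+ k) := k :+ :0) refl (log₂ x) (log₂ (x ⁻¹)))

    1≤log₂2 : 1# ≤ log₂ 2#
    1≤log₂2 = subst₂ _≤_ (+-identityʳ 1#) (solve 1 (λ l → :0 :+ (:1 :+ :0) :* l := l) refl (log₂ 2#))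
      (2^≤⇒≤log₂ 0 1 0 0<2 (≤-reflexive (sym (*-identityˡ _))))

    -- The right side is the chord over [0 , 1] of a convex function. At x = 2^(-n) it is below 2.
    [1+x]^n≤1+[2^n-1]*x : ∀ {x} n → 0# ≤ x → x ≤ 1# → (1# + x) ^ℕ n ≤ 1# + (2^ n - 1#) * x
    [1+x]^n≤1+[2^n-1]*x {x} zero 0≤x x≤1 = ≤-reflexive (solve 1 (λ x → :1 := :1 :+ (:1 :- :1) :* x) refl x)
    [1+x]^n≤1+[2^n-1]*x {x} (suc n) 0≤x x≤1 = ≤-trans
      (*-monoˡ-≤ (1# + x) (0≤+ 0≤1 0≤x) ([1+x]^n≤1+[2^n-1]*x n 0≤x x≤1))
      (0≤-by (0≤* (0≤* (x≤y⇒0≤y-x (^ℕ-monoʳ {m = 0} {n = n} 1≤2 z≤n)) 0≤x) (x≤y⇒0≤y-x x≤1))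
        (solve 2 (λ x w → :1 :+ (:2 :* w :- :1) :* x
            := (:1 :+ x) :* (:1 :+ (w :- :1) :* x) :+ (w :- :1) :* x :* (:1 :- x)) refl x (2^ n)))

  abstract
    -- This is continuity of `log₂` at 1 from the right. For z = 1 + 2^(-n) the chord bound gives
    -- z^n ≤ 2, hence log₂ z ≤ 1/n.
    small-log₂ : ∀ {ε} → 0# < ε → ∃ λ z → 1# < z × log₂ z ≤ ε
    small-log₂ {ε} 0<ε with archimedean (ε ⁻¹)
    ... | n , ε⁻¹≤n = z , 0<-by 0<η refl , *-cancelˡ-≤ (ι (suc n)) (0<ι n) (≤-trans n*log≤1 1≤n*ε)
      where
      η z : ℝ
      η = (2^ (suc n)) ⁻¹
      z = 1# + η
      0<η : 0# < η
      0<η = 0<⁻¹ (0<2^ (suc n))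
      2^n*η≡1 : 2^ (suc n) * η ≡ 1#
      2^n*η≡1 = ⁻¹-inverseʳ (2^ (suc n)) (>⇒≢ (0<2^ (suc n)))
      η≤1 : η ≤ 1#
      η≤1 = ≤-trans (≤-reflexive (sym (*-identityˡ η)))
        (≤-trans (*-monoʳ-≤ η (<⇒≤ 0<η) (^ℕ-monoʳ {m = 0} {n = suc n} 1≤2 z≤n)) (≤-reflexive 2^n*η≡1))
      z^n≤2 : 2^ 0 * z ^ℕ suc n ≤ 2^ 1
      z^n≤2 = begin
        1# * z ^ℕ suc n                   ≈⟨ *-identityˡ _ ⟩
        z ^ℕ suc n                        ≤⟨ [1+x]^n≤1+[2^n-1]*x (suc n) (<⇒≤ 0<η) η≤1 ⟩
        1# + (2^ (suc n) - 1#) * η        ≤⟨ 0≤-by (<⇒≤ 0<η)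
            (solve 2 (λ w η → :1 :+ w :* η := (:1 :+ (w :- :1) :* η) :+ η) refl (2^ (suc n)) η) ⟩
        1# + 2^ (suc n) * η               ≈⟨ cong (1# +_) 2^n*η≡1 ⟩
        1# + 1#                           ≈⟨ sym (*-identityʳ 2#) ⟩
        2# * 1#                           ∎
        where open ≤-Reasoning
      n*log≤1 : ι (suc n) * log₂ z ≤ 1#
      n*log≤1 = subst₂ _≤_ (+-identityˡ _) (+-identityʳ 1#) (≤2^⇒log₂≤ n 1 0 (0<+ 0<1 (<⇒≤ 0<η)) z^n≤2)
      1≤n*ε : 1# ≤ ι (suc n) * ε
      1≤n*ε = ≤-trans (≤-reflexive (sym (⁻¹-inverseˡ 0<ε)))
        (*-monoʳ-≤ ε (<⇒≤ 0<ε) (≤-trans ε⁻¹≤n (0≤-by 0≤1 (+-comm 1# (ι n)))))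

  abstract
    n≤log₂2^n : ∀ n → ι n ≤ log₂ (2^ n)
    n≤log₂2^n n = ≤-trans (≤-reflexive (sym (*-identityʳ (ι n))))
      (≤-trans (*-monoˡ-≤ (ι n) (0≤ι n) 1≤log₂2) (≤-reflexive (sym (log₂-^ℕ n 0<2))))

  -- A gap between log₂ e and t would leave room for a factor z > 1 with tiny logarithm. If log₂ e <
  -- t, then e z still belongs to the set that e bounds; if log₂ e > t, then e / z is a smaller
  -- bound. This yields surjectivity of `log₂`.
  log₂-supremum : ∀ {t e} → 0# < e → (∀ y → 0# < y → log₂ y ≤ t → y ≤ e) →
    (∀ u → (∀ y → 0# < y → log₂ y ≤ t → y ≤ u) → e ≤ u) → log₂ e ≡ t
  log₂-supremum {t} {e} 0<e upper least = ≤-antisym log-e≤t t≤log-e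
    where
    t≤log-e : t ≤ log₂ e
    t≤log-e with lem {P = t ≤ log₂ e}
    ... | yes t≤log = t≤log
    ... | no t≰log with small-log₂ (x<y⇒0<y-x (≰⇒> t≰log))
    ...   | z , 1<z , logz≤ε = ⊥-elim (<⇒≱ (subst (_< e * z) (*-identityʳ e) (*-monoˡ-< e 0<e 1<z))
              (upper (e * z) (0<* 0<e 0<z) (≤-trans (≤-reflexive (log₂-* 0<e 0<z))
                (≤-by logz≤ε (solve 3 (λ t l k → t :+ k := (l :+ k) :+ (t :- l)) refl t (log₂ e) (log₂ z))))))
      where 0<z = <-trans 0<1 1<z
    log-e≤t : log₂ e ≤ t
    log-e≤t with lem {P = log₂ e ≤ t}
    ... | yes log≤t = log≤t
    ... | no log≰t with small-log₂ (x<y⇒0<y-x (≰⇒> log≰t))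
    ...   | z , 1<z , logz≤ε = ⊥-elim
              (<⇒≱ (subst₂ _<_ (*-identityʳ (e / z)) (trans (*-comm (e / z) z) (*-/-cancel z 0<z))
        (*-monoˡ-< (e / z) (0</ 0<e 0<z) 1<z))
              (least (e / z) λ y 0<y log≤t → log₂-cancel-≤ (0</ 0<e 0<z)
                (≤-trans log≤t (subst (t ≤_) (sym (trans (log₂-* 0<e (0<⁻¹ 0<z)) (cong (log₂ e +_) (log₂-⁻¹ 0<z))))
                  (≤-by logz≤ε (solve 3 (λ t l k → (l :+ :- k) :+ k := t :+ (l :- t)) refl t (log₂ e) (log₂ z)))))))
      where 0<z = <-trans 0<1 1<z

  abstract
    log₂-unbounded-below : ∀ t → ∃ λ y → 0# < y × log₂ y ≤ t
    log₂-unbounded-below t with archimedean (- t)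
    ... | n , -t≤n = (2^ n) ⁻¹ , 0<⁻¹ (0<2^ n) , ≤-trans (≤-reflexive (log₂-⁻¹ (0<2^ n)))
          (≤-by (+-mono-≤ -t≤n (n≤log₂2^n n))
            (solve 3 (λ t n l → t :+ (:- t :+ n) := :- l :+ (n :+ l)) refl t (ι n) (log₂ (2^ n))))

    log₂-bounded : ∀ t → ∃ λ u → ∀ y → 0# < y × log₂ y ≤ t → y ≤ u
    log₂-bounded t with archimedean t
    ... | n , t≤n = 2^ n , λ y (0<y , log≤t) → log₂-cancel-≤ (0<2^ n) (≤-trans log≤t (≤-trans t≤n (n≤log₂2^n n)))

  exp₂-exists : ∀ t → ∃ λ e → 0# < e × log₂ e ≡ t
  exp₂-exists t with log₂-unbounded-below t | log₂-bounded t
  ... | y , below | bounded with complete (λ y → 0# < y × log₂ y ≤ t) (y , below) bounded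
  ...   | e , upper , least = e , 0<e , log₂-supremum 0<e (λ y 0<y log≤t → upper y (0<y , log≤t))
            (λ u ub → least u λ y (0<y , log≤t) → ub y 0<y log≤t)
    where
    0<e : 0# < e
    0<e = <-≤-trans (proj₁ below) (upper y below)

  abstract
    exp₂ : ℝ → ℝ
    exp₂ t = proj₁ (exp₂-exists t)

    0<exp₂ : ∀ t → 0# < exp₂ t
    0<exp₂ t = proj₁ (proj₂ (exp₂-exists t))

    log₂-exp₂ : ∀ t → log₂ (exp₂ t) ≡ t
    log₂-exp₂ t = proj₂ (proj₂ (exp₂-exists t))

  exp₂-log₂ : ∀ {x} → 0# < x → exp₂ (log₂ x) ≡ x
  exp₂-log₂ {x} 0<x = log₂-injective (0<exp₂ (log₂ x)) 0<x (log₂-exp₂ (log₂ x))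

  exp₂-^ℕ : ∀ n t → exp₂ t ^ℕ n ≡ exp₂ (ι n * t)
  exp₂-^ℕ n t = log₂-injective (0<^ℕ n (0<exp₂ t)) (0<exp₂ (ι n * t))
    (trans (log₂-^ℕ n (0<exp₂ t)) (trans (cong (ι n *_) (log₂-exp₂ t)) (sym (log₂-exp₂ (ι n * t)))))

  exp₂-mono-≤ : ∀ {s t} → s ≤ t → exp₂ s ≤ exp₂ t
  exp₂-mono-≤ {s} {t} s≤t = log₂-cancel-≤ (0<exp₂ t) (subst₂ _≤_ (sym (log₂-exp₂ s)) (sym (log₂-exp₂ t)) s≤t)

  exp₂-neg : ∀ t → (exp₂ t) ⁻¹ ≡ exp₂ (- t)
  exp₂-neg t = log₂-injective (0<⁻¹ (0<exp₂ t)) (0<exp₂ (- t))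
    (trans (log₂-⁻¹ (0<exp₂ t)) (trans (cong -_ (log₂-exp₂ t)) (sym (log₂-exp₂ (- t)))))

-- Real powers through the logarithm.

module Powers (lem : ExcludedMiddle 0ℓ) (𝓡 : CompleteOrderedField) where

  open OrderedField lem 𝓡
  open Logarithm lem 𝓡
  open Exponential lem 𝓡
  open Analysis lem 𝓡 public
  open AddExtrema _≤_ public using (_≤⊤±; ⊥±≤_; [≤]-injective) renaming ([_] to lift)

  ≤±-trans : ∀ {x y z} → x ≤± y → y ≤± z → x ≤± z
  ≤±-trans = AddExtrema.≤±-trans _≤_ ≤-trans

  ≤±-antisym : ∀ {x y} → x ≤± y → y ≤± x → x ≡ y
  ≤±-antisym = AddExtrema.≤±-antisym-≡ _≤_ ≤-antisym

  ≤±-refl : ∀ {x} → x ≤± x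
  ≤±-refl = AddExtrema.≤±-reflexive-≡ _≤_ ≤-reflexive refl

  [x]≰⊥ : ∀ {x} → ¬ ([ x ] ≤± ⊥±)
  [x]≰⊥ Supremum≤.[ () ]

  ⊤≰[x] : ∀ {x} → ¬ (⊤± ≤± [ x ])
  ⊤≰[x] ()

  sup-unique : ∀ {S s} → IsSupremum S s → proj₁ (supremum S) ≡ s
  sup-unique {S} {s} (upper , least) =
    let s′ , upper′ , least′ = supremum S in ≤±-antisym (least′ s upper) (least s′ upper′)

  sup-real : ∀ {P : Pred ℝ 0ℓ} {s} → ∃ P → (∀ x → P x → x ≤ s) →
      (∀ u → (∀ x → P x → x ≤ u) → s ≤ u) → sup[ P ] [_] ≡ [ s ]
  sup-real {P} {s} (x₀ , x₀∈P) upper least = sup-unique ((λ { _ (x , x∈P , refl) → lift (upper x x∈P) }) , least±)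
    where
    least± : ∀ u → (∀ r → (∃ λ x → P x × r ≡ [ x ]) → r ≤± u) → [ s ] ≤± u
    least± ⊤± _ = [ s ] ≤⊤±
    least± [ u ] ub = lift (least u λ x x∈P → [≤]-injective (ub [ x ] (x , x∈P , refl)))
    least± ⊥± ub = ⊥-elim ([x]≰⊥ (ub [ x₀ ] (x₀ , x₀∈P , refl)))

  0≤log₂ : ∀ {x} → 1# ≤ x → 0# ≤ log₂ x
  0≤log₂ {x} 1≤x = subst (_≤ log₂ x) log₂-1 (log₂-mono-≤ 0<1 1≤x)

  log₂≤0 : ∀ {x} → 0# < x → x ≤ 1# → log₂ x ≤ 0#
  log₂≤0 {x} 0<x x≤1 = subst (log₂ x ≤_) log₂-1 (log₂-mono-≤ 0<x x≤1)

  root-^ℕ : ∀ {x} k m → 0# < x → exp₂ (ι m * (log₂ x / ι (suc k))) ^ℕ suc k ≡ x ^ℕ m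
  root-^ℕ {x} k m 0<x = trans (exp₂-^ℕ (suc k) _) (log₂-injective (0<exp₂ _) (0<^ℕ m 0<x)
    (trans (log₂-exp₂ _) (trans (solve 3 (λ n m l → n :* (m :* l) := m :* (n :* l))
        refl (ι (suc k)) (ι m) (log₂ x / ι (suc k)))
      (trans (cong (ι m *_) (*-/-cancel (ι (suc k)) (0<ι k))) (sym (log₂-^ℕ m 0<x))))))

  -- On the logarithmic scale the elements of `BelowPower` are at most (m/n) log₂ x with m/n ≤ p.
  -- Because log₂ x ≥ 0, letting m/n approach p gives the supremum p log₂ x.
  x≥1-power≡exp₂ : ∀ {x p} → 1# ≤ x → 0# < p → x≥1-power x p ≡ exp₂ (p * log₂ x)
  x≥1-power≡exp₂ {x} {p} 1≤x 0<p = cong toℝ (sup-real (1# , 1∈) upper least)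
    where
    0<x : 0# < x
    0<x = <-≤-trans 0<1 1≤x
    1∈ : BelowPower x p 1#
    1∈ = 0≤1 , 0 , 0 , ≤-trans (<⇒≤ 0<p) (≤-reflexive (sym (+-identityʳ p))) , ≤-reflexive (*-identityʳ 1#)
    upper : ∀ y → BelowPower x p y → y ≤ exp₂ (p * log₂ x)
    upper y (0≤y , m , k , m≤np , yⁿ≤xᵐ) with lem {P = 0# ≡ y}
    -- `log₂` has a junk value at 0, so y = 0 is settled separately.
    ... | yes refl = <⇒≤ (0<exp₂ _)
    ... | no 0≢y = log₂-cancel-≤ (0<exp₂ _)
              (subst (log₂ y ≤_) (sym (log₂-exp₂ _)) (*-cancelˡ-≤ (ι (suc k)) (0<ι k) (begin
        ι (suc k) * log₂ y         ≈⟨ log₂-^ℕ (suc k) (0≤y , 0≢y) ⟨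
        log₂ (y ^ℕ suc k)          ≤⟨ log₂-mono-≤ (0<^ℕ (suc k) (0≤y , 0≢y)) yⁿ≤xᵐ ⟩
        log₂ (x ^ℕ m)              ≈⟨ log₂-^ℕ m 0<x ⟩
        ι m * log₂ x               ≤⟨ *-monoʳ-≤ (log₂ x) (0≤log₂ 1≤x) (subst (ι m ≤_) (×ℕ≡ι* (suc k) p) m≤np) ⟩
        ι (suc k) * p * log₂ x     ≈⟨ *-assoc (ι (suc k)) p (log₂ x) ⟩
        ι (suc k) * (p * log₂ x)   ∎)))
      where open ≤-Reasoning
    least : ∀ u → (∀ y → BelowPower x p y → y ≤ u) → exp₂ (p * log₂ x) ≤ u
    least u ub = log₂-cancel-≤ 0<u (subst (_≤ log₂ u) (sym (log₂-exp₂ _)) (≤-by-scaling (log₂ x) approx))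
      where
      0<u : 0# < u
      0<u = <-≤-trans 0<1 (ub 1# 1∈)
      approx : ∀ k → ι (suc k) * (p * log₂ x) ≤ ι (suc k) * log₂ u + log₂ x
      -- Rounding n p down to m changes the exponent by at most 1/n, which costs a single log₂ x
      -- after scaling by n.
      approx k with floor (ι (suc k) * p) (0≤* (0≤ι (suc k)) (<⇒≤ 0<p))
      ... | m , m≤np , np≤1+m = begin
          ι (suc k) * (p * log₂ x)   ≈⟨ *-assoc (ι (suc k)) p (log₂ x) ⟨
          ι (suc k) * p * log₂ x     ≤⟨ *-monoʳ-≤ (log₂ x) (0≤log₂ 1≤x) np≤1+m ⟩
          ι (suc m) * log₂ x         ≈⟨ solve 2 (λ m l → (:1 :+ m) :* l := m :* l :+ l) refl (ι m) (log₂ x) ⟩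
          ι m * log₂ x + log₂ x      ≤⟨ +-mono-≤ m*log≤n*log ≤-refl ⟩
          ι (suc k) * log₂ u + log₂ x ∎
        where
        open ≤-Reasoning
        t : ℝ
        t = ι m * (log₂ x / ι (suc k))
        n*t≡ : ι (suc k) * t ≡ ι m * log₂ x
        n*t≡ = trans (solve 3 (λ n m l → n :* (m :* l) := m :* (n :* l)) refl (ι (suc k)) (ι m) (log₂ x / ι (suc k)))
          (cong (ι m *_) (*-/-cancel (ι (suc k)) (0<ι k)))
        exp-t≤u : exp₂ t ≤ u
        exp-t≤u = ub (exp₂ t) (<⇒≤ (0<exp₂ t) , m , k , subst (ι m ≤_) (sym (×ℕ≡ι* (suc k) p)) m≤np , ≤-reflexive
            (root-^ℕ k m 0<x))
        m*log≤n*log : ι m * log₂ x ≤ ι (suc k) * log₂ u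
        m*log≤n*log = subst (_≤ ι (suc k) * log₂ u) n*t≡ (*-monoˡ-≤ (ι (suc k)) (0≤ι (suc k))
          (subst (_≤ log₂ u) (log₂-exp₂ t) (log₂-mono-≤ (0<exp₂ t) exp-t≤u)))

  0^ : ∀ p → 0# ^ p ≡ 0#
  0^ p with lem {P = 0# ≡ 0#} | lem {P = 1# ≤ 0#}
  ... | yes _ | _ = refl
  ... | no 0≢0 | _ = ⊥-elim (0≢0 refl)

  -- One formula covers both branches of the definition: below 1, the two inversions each reverse
  -- the sign of the exponent.
  ^≡exp₂ : ∀ {x p} → 0# < x → 0# < p → x ^ p ≡ exp₂ (p * log₂ x)
  ^≡exp₂ {x} {p} 0<x 0<p with lem {P = x ≡ 0#} | lem {P = 1# ≤ x}
  ... | yes x≡0 | _ = ⊥-elim (>⇒≢ 0<x x≡0)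
  ... | no _ | yes 1≤x = x≥1-power≡exp₂ 1≤x 0<p
  ... | no _ | no 1≰x = trans (cong _⁻¹ (x≥1-power≡exp₂ 1≤x⁻¹ 0<p)) (trans (exp₂-neg _) (cong exp₂
      (trans (cong (λ l → - (p * l)) (log₂-⁻¹ 0<x)) (solve 2 (λ p l → :- (p :* (:- l)) := p :* l) refl p (log₂ x)))))
    where
    1≤x⁻¹ : 1# ≤ x ⁻¹
    1≤x⁻¹ = *-cancelˡ-≤ x 0<x (subst₂ _≤_ (sym (*-identityʳ x)) (sym (⁻¹-inverseʳ x (>⇒≢ 0<x))) (<⇒≤ (≰⇒> 1≰x)))

  -- The laws of powers are proved by comparing logarithms; the base 0 has to be split off and is
  -- handled by `0^`.
  0≡⊎0< : ∀ {x} → 0# ≤ x → 0# ≡ x ⊎ 0# < x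
  0≡⊎0< {x} 0≤x with lem {P = 0# ≡ x}
  ... | yes 0≡x = inj₁ 0≡x
  ... | no 0≢x = inj₂ (0≤x , 0≢x)

  0<^ : ∀ {x p} → 0# < x → 0# < p → 0# < x ^ p
  0<^ 0<x 0<p = subst (0# <_) (sym (^≡exp₂ 0<x 0<p)) (0<exp₂ _)

  0≤^ : ∀ {x p} → 0# ≤ x → 0# < p → 0# ≤ x ^ p
  0≤^ {x} {p} 0≤x 0<p with 0≡⊎0< 0≤x
  ... | inj₁ refl = ≤-reflexive (sym (0^ p))
  ... | inj₂ 0<x = <⇒≤ (0<^ 0<x 0<p)

  log₂-^ : ∀ {x p} → 0# < x → 0# < p → log₂ (x ^ p) ≡ p * log₂ x
  log₂-^ 0<x 0<p = trans (cong log₂ (^≡exp₂ 0<x 0<p)) (log₂-exp₂ _)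

  ^-* : ∀ {x y p} → 0# ≤ x → 0# ≤ y → 0# < p → (x * y) ^ p ≡ x ^ p * y ^ p
  ^-* {x} {y} {p} 0≤x 0≤y 0<p with 0≡⊎0< 0≤x | 0≡⊎0< 0≤y
  ... | inj₁ refl | _ = trans (cong (_^ p) (zeroˡ y)) (trans (0^ p) (sym (trans (cong (_* y ^ p) (0^ p)) (zeroˡ _))))
  ... | inj₂ _ | inj₁ refl = trans (cong (_^ p) (zeroʳ x))
            (trans (0^ p) (sym (trans (cong (x ^ p *_) (0^ p)) (zeroʳ _))))
  ... | inj₂ 0<x | inj₂ 0<y = log₂-injective (0<^ (0<* 0<x 0<y) 0<p) (0<* (0<^ 0<x 0<p) (0<^ 0<y 0<p))
      (trans (log₂-^ (0<* 0<x 0<y) 0<p) (trans (cong (p *_) (log₂-* 0<x 0<y)) (trans (distribˡ p (log₂ x) (log₂ y))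
        (sym (trans (log₂-* (0<^ 0<x 0<p) (0<^ 0<y 0<p)) (cong₂ _+_ (log₂-^ 0<x 0<p) (log₂-^ 0<y 0<p)))))))

  ^-+ : ∀ {x p q} → 0# ≤ x → 0# < p → 0# < q → x ^ (p + q) ≡ x ^ p * x ^ q
  ^-+ {x} {p} {q} 0≤x 0<p 0<q with 0≡⊎0< 0≤x
  ... | inj₁ refl = trans (0^ _) (sym (trans (cong (_* 0# ^ q) (0^ p)) (zeroˡ _)))
  ... | inj₂ 0<x = log₂-injective (0<^ 0<x (0<+ 0<p (<⇒≤ 0<q))) (0<* (0<^ 0<x 0<p) (0<^ 0<x 0<q))
      (trans (log₂-^ 0<x (0<+ 0<p (<⇒≤ 0<q))) (trans (distribʳ (log₂ x) p q)
        (sym (trans (log₂-* (0<^ 0<x 0<p) (0<^ 0<x 0<q)) (cong₂ _+_ (log₂-^ 0<x 0<p) (log₂-^ 0<x 0<q))))))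

  ^-^ : ∀ {x p q} → 0# ≤ x → 0# < p → 0# < q → (x ^ p) ^ q ≡ x ^ (p * q)
  ^-^ {x} {p} {q} 0≤x 0<p 0<q with 0≡⊎0< 0≤x
  ... | inj₁ refl = trans (cong (_^ q) (0^ p)) (trans (0^ q) (sym (0^ _)))
  ... | inj₂ 0<x = log₂-injective (0<^ (0<^ 0<x 0<p) 0<q) (0<^ 0<x (0<* 0<p 0<q))
      (trans (log₂-^ (0<^ 0<x 0<p) 0<q) (trans (cong (q *_) (log₂-^ 0<x 0<p))
        (trans (solve 3 (λ p q l → q :* (p :* l) := p :* q :* l) refl p q (log₂ x))
            (sym (log₂-^ 0<x (0<* 0<p 0<q))))))

  ^-1 : ∀ {x} → 0# ≤ x → x ^ 1# ≡ x
  ^-1 {x} 0≤x with 0≡⊎0< 0≤x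
  ... | inj₁ refl = 0^ 1#
  ... | inj₂ 0<x = log₂-injective (0<^ 0<x 0<1) 0<x (trans (log₂-^ 0<x 0<1) (*-identityˡ _))

  ^-⁻¹ : ∀ {x p} → 0# < x → 0# < p → (x ⁻¹) ^ p ≡ (x ^ p) ⁻¹
  ^-⁻¹ {x} {p} 0<x 0<p = log₂-injective (0<^ (0<⁻¹ 0<x) 0<p) (0<⁻¹ (0<^ 0<x 0<p))
    (trans (log₂-^ (0<⁻¹ 0<x) 0<p) (trans (cong (p *_) (log₂-⁻¹ 0<x))
      (trans (solve 2 (λ p l → p :* (:- l) := :- (p :* l)) refl p (log₂ x))
          (sym (trans (log₂-⁻¹ (0<^ 0<x 0<p)) (cong -_ (log₂-^ 0<x 0<p)))))))

  ^-mono-< : ∀ {x y p} → 0# ≤ x → x < y → 0# < p → x ^ p < y ^ p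
  ^-mono-< {x} {y} {p} 0≤x x<y 0<p with 0≡⊎0< 0≤x
  ... | inj₁ refl = subst (_< y ^ p) (sym (0^ p)) (0<^ x<y 0<p)
  ... | inj₂ 0<x = ≰⇒> λ yᵖ≤xᵖ → <⇒≱ (*-monoˡ-< p 0<p (log₂-mono-< 0<x x<y))
      (subst₂ _≤_ (log₂-^ 0<y 0<p) (log₂-^ 0<x 0<p) (log₂-mono-≤ (0<^ 0<y 0<p) yᵖ≤xᵖ))
    where
    0<y : 0# < y
    0<y = <-trans 0<x x<y

  ^-mono-≤ : ∀ {x y p} → 0# ≤ x → x ≤ y → 0# < p → x ^ p ≤ y ^ p
  ^-mono-≤ {x} {y} 0≤x x≤y 0<p with lem {P = x ≡ y}
  ... | yes refl = ≤-refl
  ... | no x≢y = <⇒≤ (^-mono-< 0≤x (x≤y , x≢y) 0<p)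

-- Bernoulli's and Young's inequalities, and convexity.

module PowerInequalities (lem : ExcludedMiddle 0ℓ) (𝓡 : CompleteOrderedField) where

  open OrderedField lem 𝓡
  open Logarithm lem 𝓡
  open Exponential lem 𝓡
  open Powers lem 𝓡

  module _ {z p : ℝ} (0<z : 0# < z) (1<p : 1# < p) where

    private
      0<p : 0# < p
      0<p = <-trans 0<1 1<p

    -- With u the n-th root of z this is the integer inequality m (u^n - 1) ≤ n (u^m - 1), followed
    -- by u^m ≤ z^p. The hypothesis compares multiples of log₂ z, and not m with n p, so that it
    -- serves both signs of the logarithm.
    bernoulli-rational : ∀ k m → suc k ℕ.≤ m → ι m * log₂ z ≤ ι (suc k) * p * log₂ z →
      ι m * (z - 1#) ≤ ι (suc k) * (z ^ p - 1#)
    bernoulli-rational k m n≤m m*log≤np*log = begin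
        ι m * (z - 1#)                    ≈⟨ cong (λ w → ι m * (w - 1#)) uⁿ≡z ⟨
        ι m * (u ^ℕ suc k - 1#)           ≤⟨ m*[uⁿ-1]≤n*[uᵐ-1] m (suc k) (<⇒≤ (0<exp₂ _)) n≤m ⟩
        ι (suc k) * (u ^ℕ m - 1#)         ≤⟨ *-monoˡ-≤ (ι (suc k)) (0≤ι (suc k)) (+-mono-≤ uᵐ≤zᵖ ≤-refl) ⟩
        ι (suc k) * (z ^ p - 1#)          ∎
      where
      open ≤-Reasoning
      t u : ℝ
      t = log₂ z / ι (suc k)
      u = exp₂ t
      uⁿ≡z : u ^ℕ suc k ≡ z
      uⁿ≡z = trans (exp₂-^ℕ (suc k) t) (trans (cong exp₂ (*-/-cancel (ι (suc k)) (0<ι k))) (exp₂-log₂ 0<z))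
      m*t≤p*log : ι m * t ≤ p * log₂ z
      m*t≤p*log = *-cancelˡ-≤ (ι (suc k)) (0<ι k) (subst₂ _≤_
        (trans (cong (ι m *_) (sym (*-/-cancel (ι (suc k)) (0<ι k))))
            (solve 3 (λ n m t → m :* (n :* t) := n :* (m :* t)) refl (ι (suc k)) (ι m) t))
        (*-assoc (ι (suc k)) p (log₂ z)) m*log≤np*log)
      uᵐ≤zᵖ : u ^ℕ m ≤ z ^ p
      uᵐ≤zᵖ = subst₂ _≤_ (sym (exp₂-^ℕ m t)) (sym (^≡exp₂ 0<z 0<p)) (exp₂-mono-≤ m*t≤p*log)

    private
      Floor : ℕ → ℕ → Set
      Floor k m = ι m ≤ ι (suc k) * p × ι (suc k) * p ≤ ι (suc m)

      floor-np : ∀ k → ∃ (Floor k)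
      floor-np k = floor (ι (suc k) * p) (0≤* (0≤ι (suc k)) (<⇒≤ 0<p))

      n≤m : ∀ {k m} → Floor k m → suc k ℕ.≤ m
      n≤m {k} {m} (_ , np≤1+m) with ℕ.≤-<-connex (suc k) m
      ... | inj₁ n≤m = n≤m
      ... | inj₂ m<n = ⊥-elim (<⇒≱ (subst (_< ι (suc k) * p) (*-identityʳ _) (*-monoˡ-< (ι (suc k)) (0<ι k) 1<p))
              (≤-trans np≤1+m (ι-mono m<n)))

      above : 1# ≤ z → ∀ k m → Floor k m → ι (suc k) * (p * (z - 1#)) ≤ ι (suc k) * (z ^ p - 1#) + (z - 1#)
      above 1≤z k m fl@(m≤np , np≤1+m) = ≤-by
        (+-mono-≤ (bernoulli-rational k m (n≤m fl) (*-monoʳ-≤ (log₂ z) (0≤log₂ 1≤z) m≤np))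
          (*-monoʳ-≤ (z - 1#) (x≤y⇒0≤y-x 1≤z) np≤1+m))
        (solve 5 (λ n m p e r → (n :* r :+ e) :+ (m :* e :+ n :* p :* e)
            := n :* (p :* e) :+ (n :* r :+ (:1 :+ m) :* e))
          refl (ι (suc k)) (ι m) p (z - 1#) (z ^ p - 1#))

      -- As log₂ z ≤ 0 here, the exponent has to be rounded up: m + 1 replaces m.
      below : z ≤ 1# → ∀ k m → Floor k m → ι (suc k) * (p * (z - 1#)) ≤ ι (suc k) * (z ^ p - 1#) + (1# - z)
      below z≤1 k m fl@(m≤np , np≤1+m) = ≤-by
        (+-mono-≤ (bernoulli-rational k (suc m) (ℕ.m≤n⇒m≤1+n (n≤m fl))
            (≤-by (*-monoʳ-≤ (- log₂ z) 0≤-log np≤1+m)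
              (solve 3 (λ m np l → np :* l :+ np :* (:- l) := m :* l :+ m :* (:- l))
                  refl (ι (suc m)) (ι (suc k) * p) (log₂ z))))
          (*-monoʳ-≤ (1# - z) (x≤y⇒0≤y-x z≤1) m≤np))
        (solve 5 (λ n m p z r → (n :* r :+ (:1 :- z)) :+ ((:1 :+ m) :* (z :- :1) :+ m :* (:1 :- z))
            := n :* (p :* (z :- :1)) :+ (n :* r :+ n :* p :* (:1 :- z)))
          refl (ι (suc k)) (ι m) p z (z ^ p - 1#))
        where
        0≤-log : 0# ≤ - log₂ z
        0≤-log = ≤-by (log₂≤0 0<z z≤1) (solve 1 (λ l → :- l :+ l := :0 :+ :0) refl (log₂ z))

    -- The rounding of n p costs at most |z - 1|, which disappears after division by n. The
    -- inequality is the tangent line of z^p at 1.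
    bernoulli : p * (z - 1#) ≤ z ^ p - 1#
    bernoulli with ≤-total 1# z
    ... | inj₁ 1≤z = ≤-by-scaling (z - 1#) λ k → above 1≤z k (proj₁ (floor-np k)) (proj₂ (floor-np k))
    ... | inj₂ z≤1 = ≤-by-scaling (1# - z) λ k → below z≤1 k (proj₁ (floor-np k)) (proj₂ (floor-np k))

  module _ {p : ℝ} (1<p : 1# < p) where

    private
      0<p : 0# < p
      0<p = <-trans 0<1 1<p

    0<p-1 : 0# < p - 1#
    0<p-1 = x<y⇒0<y-x 1<p

    x^p≡x*x^[p-1] : ∀ {x} → 0# ≤ x → x ^ p ≡ x * x ^ (p - 1#)
    x^p≡x*x^[p-1] {x} 0≤x = trans (cong (x ^_) (solve 1 (λ p → p := :1 :+ (p :- :1)) refl p))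
      (trans (^-+ 0≤x 0<1 0<p-1) (cong (_* x ^ (p - 1#)) (^-1 0≤x)))

    abstract
      -- For positive x and y this is Bernoulli's inequality at z = x / y, multiplied by y^p.
      young : ∀ {x y} → 0# ≤ x → 0# ≤ y → p * (x * y ^ (p - 1#)) ≤ x ^ p + (p - 1#) * y ^ p
      young {x} {y} 0≤x 0≤y with 0≡⊎0< 0≤x | 0≡⊎0< 0≤y
      ... | inj₁ refl | _ = ≤-trans (≤-reflexive (solve 2 (λ p w → p :* (:0 :* w) := :0) refl p (y ^ (p - 1#))))
              (0≤+ (0≤^ ≤-refl 0<p) (0≤* (<⇒≤ 0<p-1) (0≤^ 0≤y 0<p)))
      ... | inj₂ _ | inj₁ refl = ≤-trans
                (≤-reflexive (trans (cong (λ w → p * (x * w)) (0^ (p - 1#)))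
          (solve 2 (λ p x → p :* (x :* :0) := :0) refl p x)))
              (0≤+ (0≤^ 0≤x 0<p) (0≤* (<⇒≤ 0<p-1) (0≤^ ≤-refl 0<p)))
      ... | inj₂ 0<x | inj₂ 0<y = subst₂ (λ a b → p * a ≤ b + (p - 1#) * y ^ p) lhs rhs
              (≤-by (*-monoˡ-≤ (y ^ p) (<⇒≤ (0<^ 0<y 0<p)) (bernoulli (0</ 0<x 0<y) 1<p))
                (solve 4 (λ p w z r → (w :* r :+ (p :- :1) :* w) :+ w :* (p :* (z :- :1))
                    := p :* (w :* z) :+ w :* (r :- :1))
                  refl p (y ^ p) (x / y) ((x / y) ^ p)))
        where
        lhs : y ^ p * (x / y) ≡ x * y ^ (p - 1#)
        lhs = trans (cong (_* (x / y)) (x^p≡x*x^[p-1] 0≤y))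
            (trans (solve 3 (λ y w z → y :* w :* z := (y :* z) :* w) refl y (y ^ (p - 1#)) (x / y))
          (cong (_* y ^ (p - 1#)) (*-/-cancel y 0<y)))
        rhs : y ^ p * (x / y) ^ p ≡ x ^ p
        rhs = trans (sym (^-* 0≤y (<⇒≤ (0</ 0<x 0<y)) 0<p)) (cong (_^ p) (*-/-cancel y 0<y))

      -- Young's inequality puts x^p and y^p above the tangent at t; in the weighted sum the linear
      -- terms combine by the formula for c t. The weights are not normalised, so that integers can
      -- be used without division.
      ^-convex : ∀ {a b c x y t} → 0# ≤ a → 0# ≤ b → 0# ≤ x → 0# ≤ y → 0# ≤ t → a + b ≡ c → c * t ≡ a * x + b * y →
        c * t ^ p ≤ a * x ^ p + b * y ^ p
      ^-convex {a} {b} {c} {x} {y} {t} 0≤a 0≤b 0≤x 0≤y 0≤t refl ct≡ =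
        ≤-by (+-mono-≤ (*-monoˡ-≤ a 0≤a (young 0≤x 0≤t)) (*-monoˡ-≤ b 0≤b (young 0≤y 0≤t))) (begin
            (a * x ^ p + b * y ^ p) + (a * (p * (x * w)) + b * (p * (y * w)))
              ≡⟨ solve 8 (λ a b p x y w X Y → (a :* X :+ b :* Y) :+ (a :* (p :* (x :* w)) :+ b :* (p :* (y :* w)))
                  := (a :* X :+ b :* Y) :+ p :* ((a :* x :+ b :* y) :* w))
                   refl a b p x y w (x ^ p) (y ^ p) ⟩
            (a * x ^ p + b * y ^ p) + p * ((a * x + b * y) * w)
              ≡⟨ cong (λ s → (a * x ^ p + b * y ^ p) + p * (s * w)) (sym ct≡) ⟩
            (a * x ^ p + b * y ^ p) + p * (((a + b) * t) * w)
              ≡⟨ cong (λ s → (a * x ^ p + b * y ^ p) + p * s)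
                  (trans (*-assoc (a + b) t w) (cong ((a + b) *_) (sym (x^p≡x*x^[p-1] 0≤t)))) ⟩
            (a * x ^ p + b * y ^ p) + p * ((a + b) * t ^ p)
              ≡⟨ solve 6 (λ a b p X Y T → (a :* X :+ b :* Y) :+ p :* ((a :+ b) :* T)
                  := (a :+ b) :* T :+ (a :* (X :+ (p :- :1) :* T) :+ b :* (Y :+ (p :- :1) :* T)))
                   refl a b p (x ^ p) (y ^ p) (t ^ p) ⟩
            (a + b) * t ^ p + (a * (x ^ p + (p - 1#) * t ^ p) + b * (y ^ p + (p - 1#) * t ^ p)) ∎)
        where
        open ≡-Reasoning
        w : ℝ
        w = t ^ (p - 1#)

-- The pointwise estimate by Riemann sums.

module Trapezoid (lem : ExcludedMiddle 0ℓ) (𝓡 : CompleteOrderedField) where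

  open OrderedField lem 𝓡
  open Powers lem 𝓡
  open PowerInequalities lem 𝓡

  -- The points t j divide [β , α] into n equal parts: the claim is the sum over the parts of the tangent
  -- inequality, Young's inequality and the convexity of x ^ p, up to an error of order 1 / n.
  module _ {p : ℝ} (1<p : 1# < p) {α β s : ℝ} (0≤β : 0# ≤ β) (β≤α : β ≤ α) (0≤s : 0# ≤ s) where

    private
      0<p : 0# < p
      0<p = <-trans 0<1 1<p

      δ A B Δ D Q : ℝ
      δ = α - β
      A = α ^ p
      B = β ^ p
      Δ = δ ^ p
      D = s ^ (p - 1#)
      Q = (p - 1#) * s ^ p

      0≤δ : 0# ≤ δ
      0≤δ = x≤y⇒0≤y-x β≤α
      0≤α : 0# ≤ α
      0≤α = ≤-trans 0≤β β≤α
      0≤D : 0# ≤ D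
      0≤D = 0≤^ 0≤s (0<p-1 1<p)
      0≤Q : 0# ≤ Q
      0≤Q = 0≤* (<⇒≤ (0<p-1 1<p)) (0≤^ 0≤s 0<p)

      module _ (k : ℕ) where

        N η : ℝ
        N = ι (suc k)
        η = δ / N

        t g : ℕ → ℝ
        t j = β + ι j * η
        g j = t j ^ p

        N*η : N * η ≡ δ
        N*η = *-/-cancel N (0<ι k)

        0≤t : ∀ j → 0# ≤ t j
        0≤t j = 0≤+ 0≤β (0≤* (0≤ι j) (0≤/ 0≤δ (0<ι k)))

        w : ℕ → ℝ
        w j = t j ^ (p - 1#)

        g≡t*w : ∀ j → g j ≡ t j * w j
        g≡t*w j = x^p≡x*x^[p-1] 1<p (0≤t j)

        abstract
          -- Young's inequality at `t j` and `t (suc j)`: the slope at the right end of a part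
          -- bounds the increment over it.
          tangent : ∀ j → g (suc j) - g j ≤ p * (η * w (suc j))
          tangent j = ≤-by (young 1<p (0≤t j) (0≤t (suc j)))
            (trans (solve 5 (λ p η w β j → p :* (η :* w) :+ p :* ((β :+ j :* η) :* w)
                := p :* ((β :+ (:1 :+ j) :* η) :* w)) refl p η (w (suc j)) β (ι j))
              (trans (cong (p *_) (sym (g≡t*w (suc j))))
                (solve 3 (λ p g′ g → p :* g′ := (g′ :- g) :+ (g :+ (p :- :1) :* g′)) refl p (g (suc j)) (g j))))

          young-step : ∀ j → p * (δ * (D * w j)) ≤ Δ + Q * g j
          young-step j = subst₂ (λ a b → p * (δ * a) ≤ Δ + b) (^-* 0≤s (0≤t j) (0<p-1 1<p))
            (trans (cong ((p - 1#) *_) (^-* 0≤s (0≤t j) 0<p)) (sym (*-assoc (p - 1#) (s ^ p) (g j))))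
            (young 1<p 0≤δ (0≤* 0≤s (0≤t j)))

          convex-step : ∀ j → j ℕ.≤ suc k → N * g j ≤ ι j * A + (N - ι j) * B
          convex-step j j≤n = ^-convex 1<p (0≤ι j) (x≤y⇒0≤y-x (ι-mono j≤n)) 0≤α 0≤β (0≤t j)
            (solve 2 (λ j N → j :+ (N :- j) := N) refl (ι j) N)
            (trans (solve 4 (λ N β j η → N :* (β :+ j :* η) := N :* β :+ j :* (N :* η)) refl N β (ι j) η)
              (trans (cong (λ d → N * β + ι j * d) N*η)
                (solve 4 (λ N β j α → N :* β :+ j :* (α :- β) := j :* α :+ (N :- j) :* β) refl N β (ι j) α)))

          -- Of the two factors N, one turns the step length η into δ, and the other clears the
          -- denominator of the convex combination.
          step : ∀ j → suc j ℕ.≤ suc k →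
            N * N * D * (g (suc j) - g j) ≤ N * Δ + Q * (ι (suc j) * A + (N - ι (suc j)) * B)
          step j j<n = begin
            N * N * D * (g (suc j) - g j)              ≤⟨ *-monoˡ-≤ (N * N * D) (0≤* (0≤* 0≤N 0≤N) 0≤D) (tangent j) ⟩
            N * N * D * (p * (η * w (suc j)))          ≈⟨ solve 5
                (λ N D p η w → N :* N :* D :* (p :* (η :* w)) := N :* (p :* ((N :* η) :* (D :* w))))
                refl N D p η (w (suc j)) ⟩
            N * (p * ((N * η) * (D * w (suc j))))      ≈⟨ cong (λ d → N * (p * (d * (D * w (suc j))))) N*η ⟩
            N * (p * (δ * (D * w (suc j))))            ≤⟨ *-monoˡ-≤ N 0≤N (young-step (suc j)) ⟩
            N * (Δ + Q * g (suc j))                    ≈⟨ solve 4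
                (λ N Δ Q g → N :* (Δ :+ Q :* g) := N :* Δ :+ Q :* (N :* g)) refl N Δ Q (g (suc j)) ⟩
            N * Δ + Q * (N * g (suc j))                ≤⟨ +-monoʳ-≤ (N * Δ)
                (*-monoˡ-≤ Q 0≤Q (convex-step (suc j) j<n)) ⟩
            N * Δ + Q * (ι (suc j) * A + (N - ι (suc j)) * B) ∎
            where
            open ≤-Reasoning
            0≤N : 0# ≤ N
            0≤N = 0≤ι (suc k)

          -- The increments telescope, while the weights of A add up to 1 + ... + j; the factor 2
          -- clears the half in j (j + 1) / 2.
          sum-steps : ∀ j → j ℕ.≤ suc k →
            2# * (N * N * D * (g j - B)) ≤ 2# * (ι j * (N * Δ)) + Q *
                (ι j * (1# + ι j) * A + (2# * (N * ι j) - ι j * (1# + ι j)) * B)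
          sum-steps zero _ = ≤-reflexive (trans
            (cong (λ x → 2# * (N * N * D * (x ^ p - B))) (solve 2 (λ β η → β :+ :0 :* η := β) refl β η))
            (solve 6 (λ N D B Q A Δ → :2 :* (N :* N :* D :* (B :- B))
                := :2 :* (:0 :* (N :* Δ)) :+ Q :*
                (:0 :* (:1 :+ :0) :* A :+ (:2 :* (N :* :0) :- :0 :* (:1 :+ :0)) :* B)) refl N D B Q A Δ))
          sum-steps (suc j) j<n = ≤-by (+-mono-≤ (sum-steps j (ℕ.<⇒≤ j<n)) (*-monoˡ-≤ 2# (<⇒≤ 0<2) (step j j<n)))
            (trans (solve 5 (λ R c g g′ B → R :+ (:2 :* (c :* (g :- B)) :+ :2 :* (c :* (g′ :- g)))
                := :2 :* (c :* (g′ :- B)) :+ R) refl R (N * N * D) (g j) (g (suc j)) B)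
              (cong (2# * (N * N * D * (g (suc j) - B)) +_)
                (solve 6 (λ j N Δ Q A B → :2 :* ((:1 :+ j) :* (N :* Δ)) :+ Q :*
                    ((:1 :+ j) :* (:1 :+ (:1 :+ j)) :* A :+
                    (:2 :* (N :* (:1 :+ j)) :- (:1 :+ j) :* (:1 :+ (:1 :+ j))) :* B)
                  := (:2 :* (j :* (N :* Δ)) :+ Q :* (j :* (:1 :+ j) :* A :+ (:2 :* (N :* j) :- j :* (:1 :+ j)) :* B))
                      :+ :2 :* (N :* Δ :+ Q :* ((:1 :+ j) :* A :+ (N :- (:1 :+ j)) :* B)))
                  refl (ι j) N Δ Q A B)))
            where
            R : ℝ
            R = 2# * (ι (suc j) * (N * Δ)) + Q *
                (ι (suc j) * (1# + ι (suc j)) * A + (2# * (N * ι (suc j)) - ι (suc j) * (1# + ι (suc j))) * B)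

          -- Sampling at right ends gives A and B the total weights (N + 1)/2 and (N - 1)/2 in place
          -- of N/2. The surplus Q (A - B) does not grow with N, so it vanishes in the limit.
          discretised : N * (2# * (D * (A - B))) ≤ N * (2# * Δ + Q * (A + B)) + Q * (A - B)
          discretised = *-cancelˡ-≤ N (0<ι k) (subst₂ _≤_ lhs rhs (sum-steps (suc k) ℕ.≤-refl))
            where
            lhs : 2# * (N * N * D * (g (suc k) - B)) ≡ N * (N * (2# * (D * (A - B))))
            lhs = trans (cong (λ x → 2# * (N * N * D * (x ^ p - B)))
                (trans (cong (β +_) N*η) (solve 2 (λ α β → β :+ (α :- β) := α) refl α β)))
              (solve 4 (λ N D A B → :2 :* (N :* N :* D :* (A :- B)) := N :* (N :* (:2 :* (D :* (A :- B)))))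
                  refl N D A B)
            rhs : 2# * (N * (N * Δ)) + Q * (N * (1# + N) * A + (2# * (N * N) - N * (1# + N)) * B) ≡ N *
                (N * (2# * Δ + Q * (A + B)) + Q * (A - B))
            rhs = solve 5 (λ N Δ Q A B → :2 :* (N :* (N :* Δ)) :+ Q :*
                (N :* (:1 :+ N) :* A :+ (:2 :* (N :* N) :- N :* (:1 :+ N)) :* B)
              := N :* (N :* (:2 :* Δ :+ Q :* (A :+ B)) :+ Q :* (A :- B))) refl N Δ Q A B

    abstract
      power-difference : 2# * (s ^ (p - 1#) * (α ^ p - β ^ p)) ≤ 2# * (α - β) ^ p + (p - 1#) * s ^ p * (α ^ p + β ^ p)
      power-difference = ≤-by-scaling (Q * (A - B)) discretised

-- Positive parts, absolute values and the edge inequality.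

module AbsoluteValue (lem : ExcludedMiddle 0ℓ) (𝓡 : CompleteOrderedField) where

  open OrderedField lem 𝓡
  open Powers lem 𝓡
  open PowerInequalities lem 𝓡
  open Trapezoid lem 𝓡
  private module Max = Algebra.Construct.NaturalChoice.Max totalOrder

  infix 9 _⁺
  _⁺ : ℝ → ℝ
  x ⁺ = x ⊔ 0#

  abstract
    -‿nonneg : ∀ {x} → x ≤ 0# → 0# ≤ - x
    -‿nonneg {x} x≤0 = ≤-by x≤0 (solve 1 (λ x → :- x :+ x := :0 :+ :0) refl x)

    0≤x⇒x⁺≡x : ∀ {x} → 0# ≤ x → x ⁺ ≡ x
    0≤x⇒x⁺≡x = Max.x≤y⇒y⊔x≈y

    x≤0⇒x⁺≡0 : ∀ {x} → x ≤ 0# → x ⁺ ≡ 0#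
    x≤0⇒x⁺≡0 = Max.x≤y⇒x⊔y≈y

    0≤x⁺ : ∀ x → 0# ≤ x ⁺
    0≤x⁺ x = Max.x≤y⊔x x 0#

    x≤x⁺ : ∀ x → x ≤ x ⁺
    x≤x⁺ x = Max.x≤x⊔y x 0#

    ⁺-lub : ∀ {x y} → x ≤ y → 0# ≤ y → x ⁺ ≤ y
    ⁺-lub = Max.⊔-lub

    -- Cutting off at height t is monotone and 1-Lipschitz. In the layer-cake induction this ensures
    -- that removing a layer increases the variation on no pair.
    truncation-contracts : ∀ t x y → ((x - t) ⁺ - (y - t) ⁺) ⁺ ≤ (x - y) ⁺
    truncation-contracts t x y = ⁺-lub (≤-by (⁺-lub {x - t} {(x - y) ⁺ + (y - t) ⁺}
        (≤-by (+-mono-≤ (x≤x⁺ (x - y)) (x≤x⁺ (y - t)))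
            (solve 5 (λ x y t a b → (a :+ b) :+ ((x :- y) :+ (y :- t)) := (x :- t) :+ (a :+ b))
            refl x y t ((x - y) ⁺) ((y - t) ⁺)))
        (0≤+ (0≤x⁺ (x - y)) (0≤x⁺ (y - t))))
      (solve 3 (λ a b c → c :+ a := (a :- b) :+ (c :+ b)) refl ((x - t) ⁺) ((y - t) ⁺) ((x - y) ⁺))) (0≤x⁺ (x - y))

    0≤x⇒∣x∣≡x : ∀ {x} → 0# ≤ x → ∣ x ∣ ≡ x
    0≤x⇒∣x∣≡x {x} 0≤x = Max.x≤y⇒y⊔x≈y (≤-by (0≤+ 0≤x 0≤x) (solve 1 (λ x → x :+ :0 := :- x :+ (x :+ x)) refl x))

    x≤∣x∣ : ∀ x → x ≤ ∣ x ∣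
    x≤∣x∣ x = Max.x≤x⊔y x (- x)

    -x≤∣x∣ : ∀ x → - x ≤ ∣ x ∣
    -x≤∣x∣ x = Max.x≤y⊔x x (- x)

    ∣x∣≤ : ∀ {x y} → x ≤ y → - x ≤ y → ∣ x ∣ ≤ y
    ∣x∣≤ = Max.⊔-lub

    0≤∣x∣ : ∀ x → 0# ≤ ∣ x ∣
    0≤∣x∣ x with ≤-total 0# x
    ... | inj₁ 0≤x = ≤-trans 0≤x (x≤∣x∣ x)
    ... | inj₂ x≤0 = ≤-trans (-‿nonneg x≤0) (-x≤∣x∣ x)

    0<∣x∣ : ∀ {x} → x ≢ 0# → 0# < ∣ x ∣
    0<∣x∣ {x} x≢0 = 0≤∣x∣ x , λ 0≡∣x∣ → x≢0 (≤-antisym (subst (x ≤_) (sym 0≡∣x∣) (x≤∣x∣ x))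
      (≤-by (subst (- x ≤_) (sym 0≡∣x∣) (-x≤∣x∣ x)) (solve 1 (λ x → x :+ :- x := :0 :+ :0) refl x)))

    ∣x-y∣≡∣y-x∣ : ∀ x y → ∣ x - y ∣ ≡ ∣ y - x ∣
    ∣x-y∣≡∣y-x∣ x y = ≤-antisym (half x y) (half y x)
      where
      flip : ∀ x y → - (x - y) ≡ y - x
      flip = solve 2 (λ x y → :- (x :- y) := y :- x) refl
      half : ∀ x y → ∣ x - y ∣ ≤ ∣ y - x ∣
      half x y = ∣x∣≤ (subst (_≤ ∣ y - x ∣) (flip y x) (-x≤∣x∣ (y - x)))
          (subst (_≤ ∣ y - x ∣) (sym (flip x y)) (x≤∣x∣ (y - x)))

    ∣x∣-∣y∣≤∣x-y∣ : ∀ x y → ∣ x ∣ - ∣ y ∣ ≤ ∣ x - y ∣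
    ∣x∣-∣y∣≤∣x-y∣ x y = ≤-by (∣x∣≤ {x} {∣ x - y ∣ + ∣ y ∣}
        (≤-by (+-mono-≤ (x≤∣x∣ (x - y)) (x≤∣x∣ y))
            (solve 4 (λ x y a b → (a :+ b) :+ ((x :- y) :+ y) := x :+ (a :+ b)) refl x y (∣ x - y ∣) (∣ y ∣)))
        (≤-by (+-mono-≤ (-x≤∣x∣ (x - y)) (-x≤∣x∣ y))
            (solve 4 (λ x y a b → (a :+ b) :+ (:- (x :- y) :+ :- y) := :- x :+ (a :+ b))
            refl x y (∣ x - y ∣) (∣ y ∣))))
      (solve 3 (λ a b c → a :+ b := (b :- c) :+ (a :+ c)) refl (∣ x - y ∣) (∣ x ∣) (∣ y ∣))

  module _ {p : ℝ} (1<p : 1# < p) {s : ℝ} (0≤s : 0# ≤ s) where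

    private
      0<p : 0# < p
      0<p = <-trans 0<1 1<p

      Bound : ℝ → ℝ → Set
      Bound x y = 2# * (s ^ (p - 1#) * ((∣ x ∣ ^ p - ∣ y ∣ ^ p) ⁺ + (∣ y ∣ ^ p - ∣ x ∣ ^ p) ⁺)) ≤
                  2# * ∣ x - y ∣ ^ p + (p - 1#) * s ^ p * (∣ x ∣ ^ p + ∣ y ∣ ^ p)

      ordered : ∀ x y → ∣ y ∣ ≤ ∣ x ∣ → Bound x y
      ordered x y ∣y∣≤∣x∣ = ≤-trans (≤-reflexive (cong (λ z → 2# * (s ^ (p - 1#) * z)) positive-parts))
          (≤-trans (power-difference 1<p (0≤∣x∣ y) ∣y∣≤∣x∣ 0≤s)
            (+-mono-≤ (*-monoˡ-≤ 2# (<⇒≤ 0<2) (^-mono-≤ (x≤y⇒0≤y-x ∣y∣≤∣x∣) (∣x∣-∣y∣≤∣x-y∣ x y) 0<p)) ≤-refl))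
        where
        yᵖ≤xᵖ : ∣ y ∣ ^ p ≤ ∣ x ∣ ^ p
        yᵖ≤xᵖ = ^-mono-≤ (0≤∣x∣ y) ∣y∣≤∣x∣ 0<p
        positive-parts : (∣ x ∣ ^ p - ∣ y ∣ ^ p) ⁺ + (∣ y ∣ ^ p - ∣ x ∣ ^ p) ⁺ ≡ ∣ x ∣ ^ p - ∣ y ∣ ^ p
        positive-parts = trans (cong₂ _+_ (0≤x⇒x⁺≡x (x≤y⇒0≤y-x yᵖ≤xᵖ))
          (x≤0⇒x⁺≡0 (≤-by yᵖ≤xᵖ (solve 2 (λ a b → :0 :+ b := (b :- a) :+ a) refl (∣ x ∣ ^ p) (∣ y ∣ ^ p)))))
              (+-identityʳ _)

    abstract
      -- The two positive parts add up to the absolute difference; they are kept apart so that each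
      -- orientation of an edge carries its own. Passing from x - y to the difference of absolute
      -- values is harmless by the reverse triangle inequality.
      edge-inequality : ∀ x y → 2# * (s ^ (p - 1#) * ((∣ x ∣ ^ p - ∣ y ∣ ^ p) ⁺ + (∣ y ∣ ^ p - ∣ x ∣ ^ p) ⁺)) ≤
        2# * ∣ x - y ∣ ^ p + (p - 1#) * s ^ p * (∣ x ∣ ^ p + ∣ y ∣ ^ p)
      edge-inequality x y with ≤-total (∣ y ∣) (∣ x ∣)
      ... | inj₁ ∣y∣≤∣x∣ = ordered x y ∣y∣≤∣x∣
      ... | inj₂ ∣x∣≤∣y∣ = subst₂ _≤_
            (cong (λ z → 2# * (s ^ (p - 1#) * z)) (+-comm _ _))
            (cong₂ (λ u v → 2# * u ^ p + (p - 1#) * s ^ p * v) (∣x-y∣≡∣y-x∣ y x) (+-comm _ _))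
            (ordered y x ∣x∣≤∣y∣)

-- Finite sums and sums in [0,∞].

module FiniteSums (lem : ExcludedMiddle 0ℓ) (𝓡 : CompleteOrderedField) where

  open OrderedField lem 𝓡
  open Powers lem 𝓡

  sum : {I : Set} → (I → ℝ) → List I → ℝ
  sum f xs = foldr _+_ 0# (map f xs)

  abstract
    sum-cong : ∀ {I : Set} {f g : I → ℝ} → (∀ x → f x ≡ g x) → ∀ xs → sum f xs ≡ sum g xs
    sum-cong f≡g [] = refl
    sum-cong f≡g (x ∷ xs) = cong₂ _+_ (f≡g x) (sum-cong f≡g xs)

    sum-mono : ∀ {I : Set} {f g : I → ℝ} → (∀ x → f x ≤ g x) → ∀ xs → sum f xs ≤ sum g xs
    sum-mono f≤g [] = ≤-refl
    sum-mono f≤g (x ∷ xs) = +-mono-≤ (f≤g x) (sum-mono f≤g xs)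

    sum-mono-All : ∀ {I : Set} {f g : I → ℝ} {xs} → All (λ x → f x ≤ g x) xs → sum f xs ≤ sum g xs
    sum-mono-All [] = ≤-refl
    sum-mono-All (fx≤gx ∷ f≤g) = +-mono-≤ fx≤gx (sum-mono-All f≤g)

    sum-+ : ∀ {I : Set} (f g : I → ℝ) xs → sum (λ x → f x + g x) xs ≡ sum f xs + sum g xs
    sum-+ f g [] = sym (+-identityʳ 0#)
    sum-+ f g (x ∷ xs) = trans (cong (f x + g x +_) (sum-+ f g xs))
      (solve 4 (λ a b c d → (a :+ b) :+ (c :+ d) := (a :+ c) :+ (b :+ d)) refl (f x) (g x) (sum f xs) (sum g xs))

    sum-* : ∀ {I : Set} c (f : I → ℝ) xs → sum (λ x → c * f x) xs ≡ c * sum f xs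
    sum-* c f [] = sym (zeroʳ c)
    sum-* c f (x ∷ xs) = trans (cong (c * f x +_) (sum-* c f xs)) (sym (distribˡ c (f x) (sum f xs)))

    0≤sum : ∀ {I : Set} {f : I → ℝ} → (∀ x → 0# ≤ f x) → ∀ xs → 0# ≤ sum f xs
    0≤sum 0≤f [] = ≤-refl
    0≤sum 0≤f (x ∷ xs) = 0≤+ (0≤f x) (0≤sum 0≤f xs)

    sum-++ : ∀ {I : Set} (f : I → ℝ) xs ys → sum f (xs ++ ys) ≡ sum f xs + sum f ys
    sum-++ f [] ys = sym (+-identityˡ (sum f ys))
    sum-++ f (x ∷ xs) ys = trans (cong (f x +_) (sum-++ f xs ys)) (sym (+-assoc (f x) (sum f xs) (sum f ys)))

    -- Each nonzero term of `xs` is matched with an occurrence in `ys`, which is then deleted;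
    -- uniqueness of `xs` means that the deleted entry is not wanted again.
    sum-⊆ : ∀ {I : Set} {f : I → ℝ} → (∀ x → 0# ≤ f x) → ∀ {xs} ys → Unique xs →
      (∀ x → x ∈ xs → f x ≢ 0# → x ∈ ys) → sum f xs ≤ sum f ys
    sum-⊆ 0≤f {[]} ys _ _ = 0≤sum 0≤f ys
    sum-⊆ {I} {f} 0≤f {x ∷ xs} ys (x∉xs ∷ xs!) xs⊆ys with lem {P = f x ≡ 0#}
    ... | yes fx≡0 = subst (_≤ sum f ys) (sym (trans (cong (_+ sum f xs) fx≡0) (+-identityˡ _)))
            (sum-⊆ 0≤f ys xs! λ z z∈xs → xs⊆ys z (there z∈xs))
    ... | no fx≢0 with ∈-∃++ (xs⊆ys x (here refl) fx≢0)
    ...   | ys₁ , ys₂ , refl = subst (sum f (x ∷ xs) ≤_) (sym split)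
              (+-monoʳ-≤ (f x) (sum-⊆ 0≤f (ys₁ ++ ys₂) xs! rest))
      where
      split : sum f (ys₁ ++ x ∷ ys₂) ≡ f x + sum f (ys₁ ++ ys₂)
      split = trans (sum-++ f ys₁ (x ∷ ys₂))
          (trans (solve 3 (λ a b c → b :+ (a :+ c) := a :+ (b :+ c)) refl (f x) (sum f ys₁) (sum f ys₂))
        (cong (f x +_) (sym (sum-++ f ys₁ ys₂))))
      rest : ∀ z → z ∈ xs → f z ≢ 0# → z ∈ ys₁ ++ ys₂
      rest z z∈xs fz≢0 with ∈-++⁻ ys₁ (xs⊆ys z (there z∈xs) fz≢0)
      ... | inj₁ z∈ys₁ = ∈-++⁺ˡ z∈ys₁
      ... | inj₂ (here refl) = ⊥-elim (All.lookup x∉xs z∈xs refl)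
      ... | inj₂ (there z∈ys₂) = ∈-++⁺ʳ ys₁ z∈ys₂

    sum-map : ∀ {I J : Set} (f : J → ℝ) (g : I → J) xs → sum f (map g xs) ≡ sum (λ x → f (g x)) xs
    sum-map f g [] = refl
    sum-map f g (x ∷ xs) = cong (f (g x) +_) (sum-map f g xs)

    sum-cartesianProduct : ∀ {I J : Set} (F : I × J → ℝ) xs ys →
      sum F (cartesianProduct xs ys) ≡ sum (λ x → sum (λ y → F (x , y)) ys) xs
    sum-cartesianProduct F [] ys = refl
    sum-cartesianProduct F (x ∷ xs) ys = trans (sum-++ F (map (x ,_) ys) (cartesianProduct xs ys))
      (cong₂ _+_ (sum-map F (x ,_) ys) (sum-cartesianProduct F xs ys))

    sum-swap : ∀ {I J : Set} (F : I → J → ℝ) xs ys →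
      sum (λ x → sum (F x) ys) xs ≡ sum (λ y → sum (λ x → F x y) xs) ys
    sum-swap {J = J} F [] ys = sym (zero-sum ys)
      where
      zero-sum : ∀ ys → sum {J} (λ _ → 0#) ys ≡ 0#
      zero-sum [] = refl
      zero-sum (y ∷ ys) = trans (+-identityˡ _) (zero-sum ys)
    sum-swap F (x ∷ xs) ys = trans (cong (sum (F x) ys +_) (sum-swap F xs ys))
      (sym (sum-+ (F x) (λ y → sum (λ x → F x y) xs) ys))

  _≟_ : {I : Set} → DecidableEquality I
  x ≟ y = lem

  nub : {I : Set} → List I → List I
  nub = deduplicate _≟_

  nub-! : ∀ {I : Set} (xs : List I) → Unique (nub xs)
  nub-! = Unique.deduplicate-! _≟_

  ∈-nub⁺ : ∀ {I : Set} {x : I} {xs} → x ∈ xs → x ∈ nub xs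
  ∈-nub⁺ = ∈-deduplicate⁺ _≟_

  ∈-nub⁻ : ∀ {I : Set} {x : I} {xs} → x ∈ nub xs → x ∈ xs
  ∈-nub⁻ {xs = xs} = ∈-deduplicate⁻ _≟_ xs

  ≤-∑ : ∀ {I : Set} {P : Pred I 0ℓ} {f : I → ℝ} {xs} → Unique xs → All P xs → [ sum f xs ] ≤± ∑[ P ] f
  ≤-∑ xs! Pxs = proj₁ (proj₂ (supremum _)) _ (_ , (xs! , Pxs) , refl)

  ∑-≤ : ∀ {I : Set} {P : Pred I 0ℓ} {f : I → ℝ} {u} →
    (∀ xs → Unique xs → All P xs → [ sum f xs ] ≤± u) → ∑[ P ] f ≤± u
  ∑-≤ ub = proj₂ (proj₂ (supremum _)) _ λ { _ (xs , (xs! , Pxs) , refl) → ub xs xs! Pxs }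

  ∑-finite : ∀ {I : Set} {P : Pred I 0ℓ} {f : I → ℝ} → (∀ x → 0# ≤ f x) → ∀ {xs} → Unique xs → All P xs →
    (∀ x → P x → f x ≢ 0# → x ∈ xs) → ∑[ P ] f ≡ [ sum f xs ]
  ∑-finite 0≤f {xs} xs! Pxs support = ≤±-antisym
    (∑-≤ λ ys ys! Pys → lift (sum-⊆ 0≤f xs ys! λ y y∈ys → support y (All.lookup Pys y∈ys)))
    (≤-∑ xs! Pxs)

  0≤∑ : ∀ {I : Set} {P : Pred I 0ℓ} {f : I → ℝ} → [ 0# ] ≤± ∑[ P ] f
  0≤∑ = ≤-∑ [] []

-- The layer-cake inequality.

module LayerCake (lem : ExcludedMiddle 0ℓ) (𝓡 : CompleteOrderedField) where

  open OrderedField lem 𝓡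
  open AbsoluteValue lem 𝓡
  open FiniteSums lem 𝓡

  minimum : ∀ {I : Set} (f : I → ℝ) x xs → ∃ λ v → v ∈ x ∷ xs × (∀ y → y ∈ x ∷ xs → f v ≤ f y)
  minimum f x [] = x , here refl , λ { _ (here refl) → ≤-refl }
  minimum f x (y ∷ ys) with minimum f y ys
  ... | v , v∈ , min with ≤-total (f x) (f v)
  ...   | inj₁ fx≤fv = x , here refl , λ { _ (here refl) → ≤-refl ; z (there z∈) → ≤-trans fx≤fv (min z z∈) }
  ...   | inj₂ fv≤fx = v , there v∈ , λ { _ (here refl) → fv≤fx ; z (there z∈) → min z z∈ }

  -- W may have infinitely many boundary edges, so the isoperimetric bound is recorded by a finite
  -- part L of the boundary.
  LargeBoundary : {X : Set} → (X → ℝ) → (X → X → ℝ) → ℝ → List X → Set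
  LargeBoundary {X} m w h W =
    ∃ λ (L : List (X × X)) → Unique L × All (λ (x , y) → x ∈ W × ¬ y ∈ W) L × h * sum m W ≤ sum (λ (x , y) → w x y) L

  Isoperimetric : {X : Set} → (X → ℝ) → (X → X → ℝ) → ℝ → Set
  Isoperimetric m w h = ∀ W → Unique W → W ≢ [] → LargeBoundary m w h W

  -- The positive part counts an edge only in its descending direction; for symmetric w, summing
  -- over ordered pairs gives half the sum of w |f x - f y|.
  variation : {X : Set} → (X → X → ℝ) → (X → ℝ) → X × X → ℝ
  variation w f (x , y) = w x y * (f x - f y) ⁺

  module _ {X : Set} {m : X → ℝ} (0≤m : ∀ x → 0# ≤ m x) {w : X → X → ℝ} (0≤w : ∀ x y → 0# ≤ w x y) where

    private
      0≤variation : ∀ f z → 0# ≤ variation w f z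
      0≤variation f (x , y) = 0≤* (0≤w x y) (0≤x⁺ (f x - f y))

    module Layer {h : ℝ} (0≤h : 0# ≤ h) {V : List X} (V! : Unique V) (f : X → ℝ)
      (f-zero : ∀ x → ¬ x ∈ V → f x ≡ 0#) {t : ℝ} (0<t : 0# < t) (t≤f : ∀ x → x ∈ V → t ≤ f x) where

      P? : ∀ x → Dec (t < f x)
      P? x = lem

      V′ : List X
      V′ = filter P? V

      f′ : X → ℝ
      f′ x = (f x - t) ⁺

      f≤t⇒f′≡0 : ∀ {x} → f x ≤ t → f′ x ≡ 0#
      f≤t⇒f′≡0 {x} fx≤t = x≤0⇒x⁺≡0 (≤-by fx≤t (solve 2 (λ a t → :0 :+ a := (a :- t) :+ t) refl (f x) t))

      f′-positive : ∀ x → x ∈ V′ → 0# < f′ x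
      f′-positive x x∈V′ = subst (0# <_) (sym (0≤x⇒x⁺≡x (<⇒≤ 0<fx-t))) 0<fx-t
        where
        0<fx-t : 0# < f x - t
        0<fx-t = x<y⇒0<y-x (proj₂ (∈-filter⁻ P? {xs = V} x∈V′))

      f′-zero : ∀ x → ¬ x ∈ V′ → f′ x ≡ 0#
      f′-zero x x∉V′ with lem {P = x ∈ V}
      ... | no x∉V = f≤t⇒f′≡0 (≤-trans (≤-reflexive (f-zero x x∉V)) (<⇒≤ 0<t))
      ... | yes x∈V with ≤-total (f x) t
      ...   | inj₁ fx≤t = f≤t⇒f′≡0 fx≤t
      ...   | inj₂ t≤fx with lem {P = t ≡ f x}
      ...     | yes t≡fx = f≤t⇒f′≡0 (≤-reflexive (sym t≡fx))
      ...     | no t≢fx = ⊥-elim (x∉V′ (∈-filter⁺ P? x∈V (t≤fx , t≢fx)))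

      mass : sum (λ x → f x * m x) V ≤ t * sum m V + sum (λ x → f′ x * m x) V′
      mass = begin
        sum (λ x → f x * m x) V                               ≤⟨ sum-mono
            (λ x → ≤-by (*-monoʳ-≤ (m x) (0≤m x) (x≤x⁺ (f x - t)))
                                                                   (solve 4 (λ f f′ t m → (t :* m :+ f′ :* m) :+
                                                                       (f :- t) :* m := f :* m :+ f′ :* m)
                                                                       refl (f x) (f′ x) t (m x))) V ⟩
        sum (λ x → t * m x + f′ x * m x) V                    ≈⟨ trans (sum-+ (λ x → t * m x) (λ x → f′ x * m x) V)
            (cong (_+ sum (λ x → f′ x * m x) V) (sum-* t m V)) ⟩
        t * sum m V + sum (λ x → f′ x * m x) V                ≤⟨ +-monoʳ-≤ (t * sum m V)
            (sum-⊆ (λ x → 0≤* (0≤x⁺ (f x - t)) (0≤m x)) V′ V! in-support) ⟩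
        t * sum m V + sum (λ x → f′ x * m x) V′               ∎
        where
        open ≤-Reasoning
        in-support : ∀ x → x ∈ V → f′ x * m x ≢ 0# → x ∈ V′
        in-support x _ f′m≢0 with lem {P = x ∈ V′}
        ... | yes x∈V′ = x∈V′
        ... | no x∉V′ = ⊥-elim (f′m≢0 (trans (cong (_* m x) (f′-zero x x∉V′)) (zeroˡ (m x))))

      -- On a pair leaving V, replacing f′ by f raises the drop by exactly t; on every other pair it
      -- lowers nothing. Hence the layer's boundary and the variation of f′ fit together into that
      -- of f, once Z contains Z′ and all endpoints of L.
      extend : ∀ {L} → Unique L → All (λ (x , y) → x ∈ V × ¬ y ∈ V) L → h * sum m V ≤ sum (λ (x , y) → w x y) L →
        ∀ {Z′} → Unique Z′ → h * sum (λ x → f′ x * m x) V′ ≤ sum (variation w f′) (cartesianProduct Z′ Z′) →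
        ∃ λ Z → Unique Z × h * sum (λ x → f x * m x) V ≤ sum (variation w f) (cartesianProduct Z Z)
      extend {L} L! L⊆∂V h*mV≤wL {Z′} Z′! ih = Z , nub-! _ , (begin
          h * sum (λ x → f x * m x) V
            ≤⟨ *-monoˡ-≤ h 0≤h mass ⟩
          h * (t * sum m V + sum (λ x → f′ x * m x) V′)
            ≈⟨ solve 4 (λ h t a b → h :* (t :* a :+ b) := t :* (h :* a) :+ h :* b)
                refl h t (sum m V) (sum (λ x → f′ x * m x) V′) ⟩
          t * (h * sum m V) + h * sum (λ x → f′ x * m x) V′
            ≤⟨ +-mono-≤ (*-monoˡ-≤ t (<⇒≤ 0<t) h*mV≤wL) ih ⟩
          t * sum (λ (x , y) → w x y) L + sum (variation w f′) (cartesianProduct Z′ Z′)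
            ≈⟨ cong (_+ sum (variation w f′) (cartesianProduct Z′ Z′)) (sum-* t (λ (x , y) → w x y) L) ⟨
          sum (λ (x , y) → t * w x y) L + sum (variation w f′) (cartesianProduct Z′ Z′)
            ≤⟨ +-mono-≤ (sum-mono-All (All.map (λ {z} → jump z) L⊆∂V)) ≤-refl ⟩
          sum gain L + sum (variation w f′) (cartesianProduct Z′ Z′)
            ≤⟨ +-mono-≤ (sum-⊆ 0≤gain ZZ L! λ z z∈L _ → ∈-cartesianProduct⁺
                (∈-nub⁺ (∈-++⁺ʳ Z′ (∈-++⁺ˡ (∈-map⁺ proj₁ z∈L))))
                (∈-nub⁺ (∈-++⁺ʳ Z′ (∈-++⁺ʳ (map proj₁ L) (∈-map⁺ proj₂ z∈L)))))
                        (sum-⊆ (0≤variation f′) ZZ (Unique.cartesianProduct⁺ Z′! Z′!) λ z z∈ _ → widen z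
                            (∈-cartesianProduct⁻ Z′ Z′ z∈)) ⟩
          sum gain ZZ + sum (variation w f′) ZZ
            ≈⟨ sum-+ gain (variation w f′) ZZ ⟨
          sum (λ z → gain z + variation w f′ z) ZZ
            ≈⟨ sum-cong (λ (x , y) → solve 3 (λ w a b → w :* (a :- b) :+ w :* b := w :* a)
                refl (w x y) ((f x - f y) ⁺) ((f′ x - f′ y) ⁺)) ZZ ⟩
          sum (variation w f) ZZ ∎)
        where
        open ≤-Reasoning
        Z : List X
        Z = nub (Z′ ++ map proj₁ L ++ map proj₂ L)
        ZZ : List (X × X)
        ZZ = cartesianProduct Z Z
        gain : X × X → ℝ
        gain (x , y) = w x y * ((f x - f y) ⁺ - (f′ x - f′ y) ⁺)
        0≤gain : ∀ z → 0# ≤ gain z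
        0≤gain (x , y) = 0≤* (0≤w x y) (x≤y⇒0≤y-x (truncation-contracts t (f x) (f y)))
        widen : ∀ ((x , y) : X × X) → x ∈ Z′ × y ∈ Z′ → (x , y) ∈ ZZ
        widen (x , y) (x∈Z′ , y∈Z′) = ∈-cartesianProduct⁺ (∈-nub⁺ (∈-++⁺ˡ x∈Z′)) (∈-nub⁺ (∈-++⁺ˡ y∈Z′))
        jump : ∀ ((x , y) : X × X) → x ∈ V × ¬ y ∈ V → t * w x y ≤ gain (x , y)
        jump (x , y) (x∈V , y∉V) = ≤-reflexive (trans (*-comm t (w x y)) (cong (w x y *_) (sym (begin-equality
          (f x - f y) ⁺ - (f′ x - f′ y) ⁺       ≈⟨ cong₂ (λ a b → (f x - a) ⁺ - (f′ x - b) ⁺) (f-zero y y∉V)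
              (f≤t⇒f′≡0 (≤-trans (≤-reflexive (f-zero y y∉V)) (<⇒≤ 0<t))) ⟩
          (f x - 0#) ⁺ - (f′ x - 0#) ⁺          ≈⟨ cong₂ (λ a b → a ⁺ - b ⁺) (x-0≡x (f x)) (x-0≡x (f′ x)) ⟩
          f x ⁺ - f′ x ⁺                        ≈⟨ cong₂ _-_ (0≤x⇒x⁺≡x (≤-trans (<⇒≤ 0<t) (t≤f x x∈V)))
              (trans (0≤x⇒x⁺≡x (0≤x⁺ (f x - t))) (0≤x⇒x⁺≡x (x≤y⇒0≤y-x (t≤f x x∈V)))) ⟩
          f x - (f x - t)                       ≈⟨ solve 2 (λ a t → a :- (a :- t) := t) refl (f x) t ⟩
          t                                     ∎))))
          where
          x-0≡x : ∀ x → x - 0# ≡ x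
          x-0≡x = solve 1 (λ x → x :- :0 := x) refl

    -- Induction on the support: t is the least positive value of f, and f = t · 1_V + (f - t)⁺.
    layer-cake : ∀ {h} → 0# ≤ h → Isoperimetric m w h → ∀ n V → length V ℕ.≤ n → Unique V → ∀ f →
      (∀ x → x ∈ V → 0# < f x) → (∀ x → ¬ x ∈ V → f x ≡ 0#) →
      ∃ λ Z → Unique Z × h * sum (λ x → f x * m x) V ≤ sum (variation w f) (cartesianProduct Z Z)
    layer-cake {h} _ _ _ [] _ _ f _ _ = [] , [] , ≤-reflexive (zeroʳ h)
    layer-cake {h} 0≤h iso (suc n) V@(x₀ ∷ V₀) (s≤s len) V! f f-pos f-zero with minimum f x₀ V₀ | iso V V! (λ ())
    ... | v , v∈V , fv≤f | L , L! , L⊆∂V , h*mV≤wL with layer-cake 0≤h iso n V′ shorter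
              (Unique.filter⁺ P? V!) f′ f′-positive f′-zero
      where
      open Layer 0≤h V! f f-zero (f-pos v v∈V) fv≤f
      shorter : length V′ ℕ.≤ n
      -- The minimiser v fails the strict test t < f v, so the filter removes at least one entry.
      shorter = ℕ.≤-pred (ℕ.<-≤-trans (filter-notAll P? V (lose v∈V λ t<t → proj₂ t<t refl)) (s≤s len))
    ...   | Z′ , Z′! , ih = Layer.extend 0≤h V! f f-zero (f-pos v v∈V) fv≤f L! L⊆∂V h*mV≤wL Z′! ih

-- Summing the edge inequality for one test function.

module Cheeger (lem : ExcludedMiddle 0ℓ) (𝓡 : CompleteOrderedField) {X : Set} (G : Analysis.Graph lem 𝓡 X)
  {p : CompleteOrderedField.ℝ 𝓡} (1<p : CompleteOrderedField._<_ 𝓡 (CompleteOrderedField.1# 𝓡) p) where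

  open OrderedField lem 𝓡
  open Powers lem 𝓡
  open PowerInequalities lem 𝓡 using (0<p-1; x^p≡x*x^[p-1])
  open AbsoluteValue lem 𝓡
  open FiniteSums lem 𝓡
  open LayerCake lem 𝓡
  open Graph G

  0<p : 0# < p
  0<p = <-trans 0<1 1<p

  module _ (φ : X → ℝ) {V : List X} (V! : Unique V) (φ-support : ∀ x → φ x ≢ 0# → x ∈ V)
      (φ≢0 : ∀ x → x ∈ V → φ x ≢ 0#) where

    φᵖ : X → ℝ
    φᵖ x = ∣ φ x ∣ ^ p

    mass : X → ℝ
    mass x = φᵖ x * m x

    edge : X × X → ℝ
    edge (x , y) = b x y * ∣ φ x - φ y ∣ ^ p

    0≤φᵖ : ∀ x → 0# ≤ φᵖ x
    0≤φᵖ x = 0≤^ (0≤∣x∣ (φ x)) 0<p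

    0≤mass : ∀ x → 0# ≤ mass x
    0≤mass x = 0≤* (0≤φᵖ x) (<⇒≤ (m-pos x))

    φ≡0⇒φᵖ≡0 : ∀ {x} → φ x ≡ 0# → φᵖ x ≡ 0#
    φ≡0⇒φᵖ≡0 {x} φx≡0 = trans (cong (λ z → ∣ z ∣ ^ p) φx≡0) (trans (cong (_^ p) (0≤x⇒∣x∣≡x ≤-refl)) (0^ p))

    mass≢0⇒∈V : ∀ x → mass x ≢ 0# → x ∈ V
    mass≢0⇒∈V x mass≢0 = φ-support x λ φx≡0 → mass≢0 (trans (cong (_* m x) (φ≡0⇒φᵖ≡0 φx≡0)) (zeroˡ (m x)))

    φᵖ-positive : ∀ x → x ∈ V → 0# < φᵖ x
    φᵖ-positive x x∈V = 0<^ (0<∣x∣ (φ≢0 x x∈V)) 0<p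

    φᵖ-zero : ∀ x → ¬ x ∈ V → φᵖ x ≡ 0#
    φᵖ-zero x x∉V with lem {P = φ x ≡ 0#}
    ... | yes φx≡0 = φ≡0⇒φᵖ≡0 φx≡0
    ... | no φx≢0 = ⊥-elim (x∉V (φ-support x φx≢0))

    module _ {d : X → X → ℝ} (d∈R : R p d) where

      flow : X → X → ℝ
      flow x y = b x y * d x y

      0≤flow : ∀ x y → 0# ≤ flow x y
      0≤flow x y = 0≤* (b-nonneg x y) (proj₁ d∈R x y)

      q : ℝ
      q = p / (p - 1#)

      private
        drop : X → X → ℝ
        drop x y = (φᵖ x - φᵖ y) ⁺

        -- The edge inequality is used with s = τ σ; the exponent 1/(p - 1) makes σ^(p-1) the weight
        -- d of the boundary and σ^p the weight d^q of the constraint in `R p`.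
        σ : X → X → ℝ
        σ x y = d x y ^ (1# / (p - 1#))

        0<1/[p-1] : 0# < 1# / (p - 1#)
        0<1/[p-1] = 0</ 0<1 (0<p-1 1<p)

        σ^[p-1] : ∀ x y → σ x y ^ (p - 1#) ≡ d x y
        σ^[p-1] x y = trans (^-^ (proj₁ d∈R x y) 0<1/[p-1] (0<p-1 1<p))
          (trans (cong (d x y ^_) (trans (*-comm _ _) (*-/-cancel (p - 1#) (0<p-1 1<p)))) (^-1 (proj₁ d∈R x y)))

        σ^p : ∀ x y → σ x y ^ p ≡ d x y ^ q
        σ^p x y = trans (^-^ (proj₁ d∈R x y) 0<1/[p-1] 0<p)
          (cong (d x y ^_) (solve 2 (λ i p → :1 :* i :* p := p :* i) refl ((p - 1#) ⁻¹) p))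

      module _ {τ : ℝ} (0≤τ : 0# ≤ τ) where

        private
          T T₁ : ℝ
          T = τ ^ p
          T₁ = τ ^ (p - 1#)

          0≤T : 0# ≤ T
          0≤T = 0≤^ 0≤τ 0<p

        -- Symmetry of b and d brings the flow term and the vertex term to the form F x y + F y x
        -- that `∬-symmetrise` handles.
        weighted-edge-inequality : ∀ x y → 2# * T₁ * (flow x y * drop x y + flow y x * drop y x) ≤
          2# * edge (x , y) + (p - 1#) * T * (b x y * d x y ^ q * φᵖ x + b y x * d y x ^ q * φᵖ y)
        weighted-edge-inequality x y = subst₂ _≤_ lhs rhs
          (*-monoˡ-≤ (b x y) (b-nonneg x y) (edge-inequality 1<p (0≤* 0≤τ 0≤σ) (φ x) (φ y)))
          where
          open ≡-Reasoning
          0≤σ : 0# ≤ σ x y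
          0≤σ = 0≤^ (proj₁ d∈R x y) 0<1/[p-1]
          lhs : b x y * (2# * ((τ * σ x y) ^ (p - 1#) * (drop x y + drop y x))) ≡ 2# * T₁ *
              (flow x y * drop x y + flow y x * drop y x)
          lhs = begin
            b x y * (2# * ((τ * σ x y) ^ (p - 1#) * (drop x y + drop y x)))
              ≡⟨ cong (λ z → b x y * (2# * (z * (drop x y + drop y x))))
                  (trans (^-* 0≤τ 0≤σ (0<p-1 1<p)) (cong (T₁ *_) (σ^[p-1] x y))) ⟩
            b x y * (2# * (T₁ * d x y * (drop x y + drop y x)))
              ≡⟨ solve 5 (λ b T d u v → b :* (:2 :* (T :* d :* (u :+ v))) := :2 :* T :* (b :* d :* u :+ b :* d :* v))
                  refl (b x y) T₁ (d x y) (drop x y) (drop y x) ⟩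
            2# * T₁ * (flow x y * drop x y + b x y * d x y * drop y x)
              ≡⟨ cong₂ (λ u v → 2# * T₁ * (flow x y * drop x y + u * v * drop y x)) (b-sym x y)
                  (proj₁ (proj₂ d∈R) x y) ⟩
            2# * T₁ * (flow x y * drop x y + flow y x * drop y x) ∎
          rhs : b x y * (2# * ∣ φ x - φ y ∣ ^ p + (p - 1#) * (τ * σ x y) ^ p * (φᵖ x + φᵖ y)) ≡
                2# * edge (x , y) + (p - 1#) * T * (b x y * d x y ^ q * φᵖ x + b y x * d y x ^ q * φᵖ y)
          rhs = begin
            b x y * (2# * ∣ φ x - φ y ∣ ^ p + (p - 1#) * (τ * σ x y) ^ p * (φᵖ x + φᵖ y))
              ≡⟨ cong (λ z → b x y * (2# * ∣ φ x - φ y ∣ ^ p + (p - 1#) * z * (φᵖ x + φᵖ y)))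
                  (trans (^-* 0≤τ 0≤σ 0<p) (cong (T *_) (σ^p x y))) ⟩
            b x y * (2# * ∣ φ x - φ y ∣ ^ p + (p - 1#) * (T * d x y ^ q) * (φᵖ x + φᵖ y))
              ≡⟨ solve 7 (λ b e r T D u v → b :* (:2 :* e :+ r :* (T :* D) :* (u :+ v))
                  := :2 :* (b :* e) :+ r :* T :* (b :* D :* u :+ b :* D :* v))
                   refl (b x y) (∣ φ x - φ y ∣ ^ p) (p - 1#) T (d x y ^ q) (φᵖ x) (φᵖ y) ⟩
            2# * edge (x , y) + (p - 1#) * T * (b x y * d x y ^ q * φᵖ x + b x y * d x y ^ q * φᵖ y)
              ≡⟨ cong₂ (λ u v → 2# * edge (x , y) + (p - 1#) * T * (b x y * d x y ^ q * φᵖ x + u * v ^ q * φᵖ y))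
                  (b-sym x y) (proj₁ (proj₂ d∈R) x y) ⟩
            2# * edge (x , y) + (p - 1#) * T * (b x y * d x y ^ q * φᵖ x + b y x * d y x ^ q * φᵖ y) ∎

        ∬ : (X → X → ℝ) → List X → ℝ
        ∬ F Z = sum (λ (x , y) → F x y) (cartesianProduct Z Z)

        -- A square Z × Z is invariant under exchange of its factors, which is why the finite sums
        -- run over squares and not over arbitrary lists of pairs.
        ∬-symmetrise : ∀ F Z → ∬ (λ x y → F x y + F y x) Z ≡ 2# * ∬ F Z
        ∬-symmetrise F Z = trans (sum-+ (λ (x , y) → F x y) (λ (x , y) → F y x) (cartesianProduct Z Z))
          (trans (cong (∬ F Z +_) swap) (solve 1 (λ a → a :+ a := :2 :* a) refl (∬ F Z)))
          where
          swap : ∬ (λ x y → F y x) Z ≡ ∬ F Z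
          swap = trans (sum-cartesianProduct (λ (x , y) → F y x) Z Z)
            (trans (sum-swap (λ x y → F y x) Z Z) (sym (sum-cartesianProduct (λ (x , y) → F x y) Z Z)))

        -- The constraint on d bounds the row of x by m x. Points of Z outside V have no mass, so Z
        -- need not be contained in V.
        vertex-bound : ∀ {Z} → Unique Z → ∬ (λ x y → b x y * d x y ^ q * φᵖ x) Z ≤ sum mass V
        vertex-bound {Z} Z! = begin
          ∬ (λ x y → b x y * d x y ^ q * φᵖ x) Z
            ≈⟨ sum-cartesianProduct (λ (x , y) → b x y * d x y ^ q * φᵖ x) Z Z ⟩
          sum (λ x → sum (λ y → b x y * d x y ^ q * φᵖ x) Z) Z
            ≤⟨ sum-mono row Z ⟩
          sum mass Z
            ≤⟨ sum-⊆ 0≤mass V Z! (λ x _ → mass≢0⇒∈V x) ⟩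
          sum mass V ∎
          where
          open ≤-Reasoning
          row : ∀ x → sum (λ y → b x y * d x y ^ q * φᵖ x) Z ≤ mass x
          row x = begin
            sum (λ y → b x y * d x y ^ q * φᵖ x) Z     ≈⟨ sum-cong (λ y → *-comm (b x y * d x y ^ q) (φᵖ x)) Z ⟩
            sum (λ y → φᵖ x * (b x y * d x y ^ q)) Z   ≈⟨ sum-* (φᵖ x) (λ y → b x y * d x y ^ q) Z ⟩
            φᵖ x * sum (λ y → b x y * d x y ^ q) Z     ≤⟨ *-monoˡ-≤ (φᵖ x) (0≤φᵖ x)
                ([≤]-injective (≤±-trans (≤-∑ Z! (All.universal (λ _ → tt) Z)) (proj₂ (proj₂ d∈R) x))) ⟩
            mass x                                     ∎

        summed-edge-inequality : ∀ {Z} → Unique Z → ∀ {e} → ∑[ U ] edge ≡ [ e ] →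
          2# * T₁ * sum (variation flow φᵖ) (cartesianProduct Z Z) ≤ e + (p - 1#) * T * sum mass V
        summed-edge-inequality {Z} Z! {e} ∑≡e = *-cancelˡ-≤ 2# 0<2 (begin
            2# * (2# * T₁ * P)
              ≈⟨ solve 2 (λ t P → :2 :* (:2 :* t :* P) := :2 :* t :* (:2 :* P)) refl T₁ P ⟩
            2# * T₁ * (2# * P)
              ≈⟨ cong (2# * T₁ *_) (∬-symmetrise (λ x y → flow x y * drop x y) Z) ⟨
            2# * T₁ * ∬ (λ x y → flow x y * drop x y + flow y x * drop y x) Z
              ≈⟨ sum-* (2# * T₁) (λ (x , y) → flow x y * drop x y + flow y x * drop y x) ZZ ⟨
            ∬ (λ x y → 2# * T₁ * (flow x y * drop x y + flow y x * drop y x)) Z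
              ≤⟨ sum-mono (λ (x , y) → weighted-edge-inequality x y) ZZ ⟩
            ∬ (λ x y → 2# * edge (x , y) + (p - 1#) * T * (B x y + B y x)) Z
              ≈⟨ sum-+ (λ (x , y) → 2# * edge (x , y)) (λ (x , y) → (p - 1#) * T * (B x y + B y x)) ZZ ⟩
            ∬ (λ x y → 2# * edge (x , y)) Z + ∬ (λ x y → (p - 1#) * T * (B x y + B y x)) Z
              ≈⟨ cong₂ _+_ (sum-* 2# edge ZZ)
                  (trans (sum-* ((p - 1#) * T) (λ (x , y) → B x y + B y x) ZZ)
                  (cong ((p - 1#) * T *_) (∬-symmetrise B Z))) ⟩
            2# * sum edge ZZ + (p - 1#) * T * (2# * ∬ B Z)
              ≤⟨ +-mono-≤ (*-monoˡ-≤ 2# (<⇒≤ 0<2) energy-bound)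
                   (*-monoˡ-≤ ((p - 1#) * T) (0≤* (<⇒≤ (0<p-1 1<p)) 0≤T) (*-monoˡ-≤ 2# (<⇒≤ 0<2) (vertex-bound Z!))) ⟩
            2# * e + (p - 1#) * T * (2# * sum mass V)
              ≈⟨ solve 3 (λ e r N → :2 :* e :+ r :* (:2 :* N) := :2 :* (e :+ r :* N))
                  refl e ((p - 1#) * T) (sum mass V) ⟩
            2# * (e + (p - 1#) * T * sum mass V) ∎)
          where
          open ≤-Reasoning
          ZZ : List (X × X)
          ZZ = cartesianProduct Z Z
          P : ℝ
          P = sum (variation flow φᵖ) ZZ
          B : X → X → ℝ
          B x y = b x y * d x y ^ q * φᵖ x
          energy-bound : sum edge ZZ ≤ e
          energy-bound = [≤]-injective (subst ([ sum edge ZZ ] ≤±_) ∑≡e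
              (≤-∑ (Unique.cartesianProduct⁺ Z! Z!) (All.universal (λ _ → tt) ZZ)))

      -- As p τ = 2h, the left side of the summed inequality becomes p τ^p N, and p - 1 of these p
      -- parts cancel against the vertex term. The number e sums over ordered pairs and is twice the
      -- energy.
      cheeger-real : ∀ {h} → 0# ≤ h → Isoperimetric m flow h → ∀ {e} → ∑[ U ] edge ≡ [ e ] →
        (2# * h / p) ^ p * sum mass V ≤ e
      cheeger-real {h} 0≤h iso {e} ∑≡e with layer-cake (λ x → <⇒≤ (m-pos x)) 0≤flow 0≤h iso
          (length V) V ℕ.≤-refl V! φᵖ φᵖ-positive φᵖ-zero
      ... | Z , Z! , hN≤P = ≤-by (≤-trans (*-monoˡ-≤ (2# * T₁) (0≤* (<⇒≤ 0<2) (0≤^ 0≤τ (0<p-1 1<p))) hN≤P)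
                (summed-edge-inequality 0≤τ Z! ∑≡e)) (begin
            e + 2# * T₁ * (h * N)
              ≡⟨ solve 4 (λ e t h N → e :+ :2 :* t :* (h :* N) := e :+ t :* (:2 :* h) :* N) refl e T₁ h N ⟩
            e + T₁ * (2# * h) * N
              ≡⟨ cong (λ z → e + T₁ * z * N) (sym (*-/-cancel p 0<p)) ⟩
            e + T₁ * (p * τ) * N
              ≡⟨ solve 5 (λ e t p τ N → e :+ t :* (p :* τ) :* N := e :+ p :* (τ :* t) :* N) refl e T₁ p τ N ⟩
            e + p * (τ * T₁) * N
              ≡⟨ cong (λ z → e + p * z * N) (sym (x^p≡x*x^[p-1] 1<p 0≤τ)) ⟩
            e + p * τ ^ p * N
              ≡⟨ solve 4 (λ e p T N → e :+ p :* T :* N := T :* N :+ (e :+ (p :- :1) :* T :* N)) refl e p (τ ^ p) N ⟩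
            τ ^ p * N + (e + (p - 1#) * τ ^ p * N) ∎)
        where
        open ≡-Reasoning
        τ T₁ N : ℝ
        τ = 2# * h / p
        T₁ = τ ^ (p - 1#)
        N = sum mass V
        0≤τ : 0# ≤ τ
        0≤τ = 0≤/ (0≤* (<⇒≤ 0<2) 0≤h) 0<p

-- Suprema, infima and infinite values.

module IsoperimetricConstant (lem : ExcludedMiddle 0ℓ) (𝓡 : CompleteOrderedField) {X : Set}
    (G : Analysis.Graph lem 𝓡 X)
  {p : CompleteOrderedField.ℝ 𝓡} (1<p : CompleteOrderedField._<_ 𝓡 (CompleteOrderedField.1# 𝓡) p) where

  open OrderedField lem 𝓡
  open Powers lem 𝓡
  open PowerInequalities lem 𝓡 using (0<p-1; x^p≡x*x^[p-1])
  open AbsoluteValue lem 𝓡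
  open FiniteSums lem 𝓡
  open LayerCake lem 𝓡
  open Graph G
  open Cheeger lem 𝓡 G 1<p

  abstract
    halfway : ∀ {x y} → x < y → ∃ λ z → x < z × z < y
    halfway {x} {y} x<y = (x + y) / 2# ,
      *-cancelˡ-< 2# (<⇒≤ 0<2) (subst (2# * x <_) (sym (*-/-cancel 2# 0<2))
          (<-by x<y (solve 2 (λ x y → (x :+ y) :+ x := :2 :* x :+ y) refl x y))) ,
      *-cancelˡ-< 2# (<⇒≤ 0<2) (subst (_< 2# * y) (sym (*-/-cancel 2# 0<2))
          (<-by x<y (solve 2 (λ x y → :2 :* y :+ x := (x :+ y) :+ y) refl x y)))

    -- A value above r may be infinite, whereas the layer-cake argument takes a real h.
    ≰±⇒real-between : ∀ {r} v → ¬ (v ≤± [ r ]) → ∃ λ h → r < h × [ h ] ≤± v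
    ≰±⇒real-between ⊥± v≰r = ⊥-elim (v≰r (⊥±≤ _))
    ≰±⇒real-between [ x ] v≰r = x , ≰⇒> (λ x≤r → v≰r (lift x≤r)) , ≤±-refl
    ≰±⇒real-between {r} ⊤± v≰r = r + 1# , 0<-by 0<1 refl , _ ≤⊤±

    ÷-monoˡ-≤ : ∀ {v x y} → 0# < y → [ 0# ] ≤± v → v ≤± [ x ] → v ÷ [ y ] ≤± [ x / y ]
    ÷-monoˡ-≤ {⊥±} _ 0≤v _ = ⊥-elim ([x]≰⊥ 0≤v)
    ÷-monoˡ-≤ {[ v ]} {x} {y} 0<y _ v≤x = lift (*-monoʳ-≤ (y ⁻¹) (<⇒≤ (0<⁻¹ 0<y)) ([≤]-injective v≤x))
    ÷-monoˡ-≤ {⊤±} _ _ v≤x = ⊥-elim (⊤≰[x] v≤x)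

    0≤÷ : ∀ {v y} → 0# < y → [ 0# ] ≤± v → [ 0# ] ≤± v ÷ [ y ]
    0≤÷ {⊥±} _ 0≤v = ⊥-elim ([x]≰⊥ 0≤v)
    0≤÷ {[ v ]} 0<y 0≤v = lift (0≤/ ([≤]-injective 0≤v) 0<y)
    0≤÷ {⊤±} _ _ = _ ≤⊤±

    0<sum-m : ∀ {W} → W ≢ [] → 0# < sum m W
    0<sum-m {[]} W≢[] = ⊥-elim (W≢[] refl)
    0<sum-m {x ∷ W} _ = 0<+ (m-pos x) (0≤sum (λ x → <⇒≤ (m-pos x)) W)

  measure≡sum : ∀ {xs W} → Unique W → (∀ {x} → x ∈ W → x ∈ xs) → (∀ {x} → x ∈ xs → x ∈ W) → measure
      (_∈ xs) ≡ [ sum m W ]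
  measure≡sum W! W⊆xs xs⊆W = ∑-finite (λ x → <⇒≤ (m-pos x)) W! (All.tabulate W⊆xs) λ x x∈xs _ → xs⊆W x∈xs

  -- If all finite parts of the boundary stayed below h m(W), their supremum would be at most h
  -- m(W), and W would force `h₀-of d` down to h. The supremum bound is not strict, hence the gap
  -- between h and h′.
  isoperimetric : ∀ {d h h′} → h < h′ → [ h′ ] ≤± h₀-of d → Isoperimetric m (λ x y → b x y * d x y) h
  isoperimetric {d} {h} {h′} h<h′ h′≤h₀ W W! W≢[] with lem {P = LargeBoundary m (λ x y → b x y * d x y) h W}
  ... | yes L = L
  ... | no ¬L = ⊥-elim (<⇒≱ h<h′ (≤-trans ([≤]-injective (≤±-trans h′≤h₀ (≤±-trans h₀≤∂W÷mW ∂W÷mW≤)))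
          (≤-reflexive (trans (*-assoc h M (M ⁻¹)) (trans (cong (h *_) (⁻¹-inverseʳ M (>⇒≢ 0<M))) (*-identityʳ h))))))
    where
    M : ℝ
    M = sum m W
    0<M : 0# < M
    0<M = 0<sum-m W≢[]
    h₀≤∂W÷mW : h₀-of d ≤± ∣∂ (_∈ W) ∣ d ÷ measure (_∈ W)
    h₀≤∂W÷mW = proj₁ (proj₂ (infimum _)) _ (W , W≢[] , refl)
    ∂W≤hM : ∣∂ (_∈ W) ∣ d ≤± [ h * M ]
    ∂W≤hM = ∑-≤ λ L L! L⊆∂W → lift (<⇒≤ (≰⇒> λ hM≤wL → ¬L (L , L! , L⊆∂W , hM≤wL)))
    ∂W÷mW≤ : ∣∂ (_∈ W) ∣ d ÷ measure (_∈ W) ≤± [ h * M / M ]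
    ∂W÷mW≤ = subst (λ v → ∣∂ (_∈ W) ∣ d ÷ v ≤± [ h * M / M ]) (sym (measure≡sum W! (λ z → z) (λ z → z)))
      (÷-monoˡ-≤ 0<M 0≤∑ ∂W≤hM)

  0≤h₀-of : ∀ d → [ 0# ] ≤± h₀-of d
  0≤h₀-of d = proj₂ (proj₂ (infimum _)) _ λ { _ (xs , xs≢[] , refl) →
    subst (λ v → [ 0# ] ≤± ∣∂ (_∈ xs) ∣ d ÷ v) (sym (measure≡sum (nub-! xs) ∈-nub⁻ ∈-nub⁺))
        (0≤÷ (0<sum-m (nub≢[] xs xs≢[])) 0≤∑) }
    where
    nub≢[] : ∀ (xs : List X) → xs ≢ [] → nub xs ≢ []
    nub≢[] [] xs≢[] _ = xs≢[] refl
    nub≢[] (_ ∷ _) _ ()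

  -- A member of `R p` keeps `h₀ p` away from `⊥±`, where the power is a junk value, and makes it
  -- nonnegative.
  zero∈R : R p (λ _ _ → 0#)
  zero∈R = (λ _ _ → ≤-refl) , (λ _ _ → refl) , λ x → ∑-≤ λ ys ys! _ → lift (≤-trans
    (sum-⊆ (λ y → ≤-reflexive (sym (vanishes x y))) [] ys! λ y _ b≢0 → ⊥-elim (b≢0 (vanishes x y)))
    (<⇒≤ (m-pos x)))
    where
    vanishes : ∀ x y → b x y * 0# ^ (p / (p - 1#)) ≡ 0#
    vanishes x y = trans (cong (b x y *_) (0^ _)) (zeroʳ (b x y))

  0≤h₀ : [ 0# ] ≤± h₀ p
  0≤h₀ = ≤±-trans (0≤h₀-of _) (proj₁ (proj₂ (supremum _)) _ (_ , zero∈R , refl))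

  c : ℝ
  c = 2# ^ (p - 1#) / p ^ p

  0<c : 0# < c
  0<c = 0</ (0<^ 0<2 (0<p-1 1<p)) (0<^ 0<p 0<p)

  -- The constant c is half of (2/p)^p: the half is that of the energy, and the rest is the power of
  -- τ = 2h/p.
  c*h^p : ∀ {h} → 0# ≤ h → c * h ^ p ≡ (1# / 2#) * (2# * h / p) ^ p
  c*h^p {h} 0≤h = sym (begin
    (1# / 2#) * (2# * h / p) ^ p
      ≡⟨ cong ((1# / 2#) *_) (trans (^-* (0≤* (<⇒≤ 0<2) 0≤h) (<⇒≤ (0<⁻¹ 0<p)) 0<p)
          (cong₂ _*_ (^-* (<⇒≤ 0<2) 0≤h 0<p) (^-⁻¹ 0<p 0<p))) ⟩
    (1# / 2#) * (2# ^ p * h ^ p / p ^ p)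
      ≡⟨ cong (λ z → (1# / 2#) * (z * h ^ p / p ^ p)) (x^p≡x*x^[p-1] 1<p (<⇒≤ 0<2)) ⟩
    (1# / 2#) * (2# * 2# ^ (p - 1#) * h ^ p / p ^ p)
      ≡⟨ solve 4 (λ i t H I → :1 :* i :* (:2 :* t :* H :* I) := (:2 :* i) :* (t :* I :* H))
          refl (2# ⁻¹) (2# ^ (p - 1#)) (h ^ p) ((p ^ p) ⁻¹) ⟩
    2# * 2# ⁻¹ * (c * h ^ p)
      ≡⟨ trans (cong (_* (c * h ^ p)) (⁻¹-inverseʳ 2# (>⇒≢ 0<2))) (*-identityˡ _) ⟩
    c * h ^ p ∎)
    where open ≡-Reasoning

  module _ (φ : X → ℝ) {V : List X} (V! : Unique V) (φ-support : ∀ x → φ x ≢ 0# → x ∈ V)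
      (φ≢0 : ∀ x → x ∈ V → φ x ≢ 0#) (V≢[] : V ≢ []) where

    private
      N : ℝ
      N = sum (mass φ V! φ-support φ≢0) V

    0<N : 0# < N
    0<N = positive V V≢[] λ x x∈V → 0<* (φᵖ-positive φ V! φ-support φ≢0 x x∈V) (m-pos x)
      where
      positive : ∀ W → W ≢ [] → (∀ x → x ∈ W → 0# < mass φ V! φ-support φ≢0 x) → 0# < sum (mass φ V! φ-support φ≢0) W
      positive [] W≢[] _ = ⊥-elim (W≢[] refl)
      positive (x ∷ W) _ pos = 0<+ (pos x (here refl)) (0≤sum (0≤mass φ V! φ-support φ≢0) W)

    norm^p : ‖ φ ‖[ p ] ^± p ≡ [ N ]
    norm^p = trans (cong (λ v → (v ^± (1# / p)) ^± p)
        (∑-finite (0≤mass φ V! φ-support φ≢0) V! (All.universal (λ _ → tt) V)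
        (λ x _ → mass≢0⇒∈V φ V! φ-support φ≢0 x)))
      (cong [_] (trans (^-^ (<⇒≤ 0<N) (0</ 0<1 0<p) 0<p)
          (trans (cong (N ^_) (trans (*-comm _ _) (*-/-cancel p 0<p))) (^-1 (<⇒≤ 0<N)))))

    module _ {e : ℝ} (∑≡e : ∑[ U ] (edge φ V! φ-support φ≢0) ≡ [ e ]) where

      private
        -- ℓ is the Rayleigh quotient of φ, and r solves c r^p = ℓ. Comparing each `h₀-of d` with r
        -- before the supremum is taken avoids any appeal to continuity of the power.
        ℓ r : ℝ
        ℓ = (1# / 2#) * e / N
        r = (ℓ / c) ^ (1# / p)

        0≤e : 0# ≤ e
        0≤e = [≤]-injective (subst ([ 0# ] ≤±_) ∑≡e 0≤∑)

        0≤ℓ : 0# ≤ ℓ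
        0≤ℓ = 0≤/ (0≤* (<⇒≤ (0</ 0<1 0<2)) 0≤e) 0<N

        0≤r : 0# ≤ r
        0≤r = 0≤^ (0≤/ 0≤ℓ 0<c) (0</ 0<1 0<p)

        c*r^p : c * r ^ p ≡ ℓ
        c*r^p = trans (cong (c *_) (trans (^-^ (0≤/ 0≤ℓ 0<c) (0</ 0<1 0<p) 0<p)
          (trans (cong ((ℓ / c) ^_) (trans (*-comm _ _) (*-/-cancel p 0<p))) (^-1 (0≤/ 0≤ℓ 0<c))))) (*-/-cancel c 0<c)

      h₀-of≤r : ∀ d → R p d → h₀-of d ≤± [ r ]
      h₀-of≤r d d∈R with lem {P = h₀-of d ≤± [ r ]}
      ... | yes h₀≤r = h₀≤r
      ... | no h₀≰r with ≰±⇒real-between _ h₀≰r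
      ...   | h′ , r<h′ , h′≤h₀ with halfway r<h′
      -- h needs room on both sides: h < h′ yields finite boundary witnesses, and r < h makes c h^p
      -- exceed ℓ.
      ...     | h , r<h , h<h′ = ⊥-elim
                (<⇒≱ (*-monoˡ-< c 0<c (^-mono-< 0≤r r<h 0<p))
          (subst (c * h ^ p ≤_) (sym c*r^p) (*-cancelˡ-≤ N 0<N (begin
          N * (c * h ^ p)                              ≈⟨ cong (N *_) (c*h^p 0≤h) ⟩
          N * ((1# / 2#) * (2# * h / p) ^ p)           ≈⟨ solve 3 (λ N i t → N :* (i :* t) := i :* (t :* N))
              refl N (1# / 2#) ((2# * h / p) ^ p) ⟩
          (1# / 2#) * ((2# * h / p) ^ p * N)           ≤⟨ *-monoˡ-≤ (1# / 2#) (<⇒≤ (0</ 0<1 0<2))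
              (cheeger-real φ V! φ-support φ≢0 d∈R 0≤h (isoperimetric h<h′ h′≤h₀) ∑≡e) ⟩
          (1# / 2#) * e                                ≈⟨ *-/-cancel N 0<N ⟨
          N * ℓ                                        ∎))))
        where
        open ≤-Reasoning
        0≤h : 0# ≤ h
        0≤h = ≤-trans 0≤r (<⇒≤ r<h)

      bound : c · (h₀ p ^± p) ≤± [ ℓ ]
      bound = conclude (h₀ p) 0≤h₀ (proj₂ (proj₂ (supremum _)) [ r ] λ { _ (d , d∈R , refl) → h₀-of≤r d d∈R })
        where
        conclude : ∀ v → [ 0# ] ≤± v → v ≤± [ r ] → c · (v ^± p) ≤± [ ℓ ]
        conclude ⊥± 0≤v _ = ⊥-elim ([x]≰⊥ 0≤v)
        conclude ⊤± _ v≤r = ⊥-elim (⊤≰[x] v≤r)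
        conclude [ s ] 0≤s s≤r = lift (subst (c * s ^ p ≤_) c*r^p
          (*-monoˡ-≤ c (<⇒≤ 0<c) (^-mono-≤ ([≤]-injective 0≤s) ([≤]-injective s≤r) 0<p)))

    quotient-bound : c · (h₀ p ^± p) ≤± energy p φ ÷ ‖ φ ‖[ p ] ^± p
    quotient-bound = subst (λ v → c · (h₀ p ^± p) ≤± energy p φ ÷ v) (sym norm^p)
        (by-energy (∑[ U ] (edge φ V! φ-support φ≢0)) refl)
      where
      by-energy : ∀ v → ∑[ U ] (edge φ V! φ-support φ≢0) ≡ v → c · (h₀ p ^± p) ≤±
          ((1# / 2#) · ∑[ U ] (edge φ V! φ-support φ≢0)) ÷ [ N ]
      by-energy ⊥± eq = ⊥-elim ([x]≰⊥ (subst ([ 0# ] ≤±_) eq 0≤∑))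
      by-energy [ e ] eq = subst (λ v → c · (h₀ p ^± p) ≤± ((1# / 2#) · v) ÷ [ N ]) (sym eq) (bound eq)
      by-energy ⊤± eq = subst (λ v → c · (h₀ p ^± p) ≤± ((1# / 2#) · v) ÷ [ N ]) (sym eq) (_ ≤⊤±)

  cheeger-inequality : c · (h₀ p ^± p) ≤± λ₀ p
  cheeger-inequality = proj₂ (proj₂ (infimum _)) _ λ { _
      (φ , ((xs , supp) , x₀ , φx₀≢0) , refl) → by-support φ xs supp x₀ φx₀≢0 }
    where
    by-support : ∀ φ xs → (∀ x → φ x ≢ 0# → x ∈ xs) → ∀ x₀ → φ x₀ ≢ 0# → c ·
        (h₀ p ^± p) ≤± energy p φ ÷ ‖ φ ‖[ p ] ^± p
    -- The layer-cake induction wants a function that is positive on the whole list, so the given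
    -- list is cut down to the exact support, which contains x₀.
    by-support φ xs supp x₀ φx₀≢0 = quotient-bound φ (Unique.filter⁺ P? (nub-! xs)) support
        (λ x x∈V → proj₂ (∈-filter⁻ P? {xs = nub xs} x∈V)) nonempty
      where
      P? : ∀ x → Dec (φ x ≢ 0#)
      P? x = lem
      support : ∀ x → φ x ≢ 0# → x ∈ filter P? (nub xs)
      support x φx≢0 = ∈-filter⁺ P? (∈-nub⁺ (supp x φx≢0)) φx≢0
      nonempty : filter P? (nub xs) ≢ []
      nonempty eq with subst (x₀ ∈_) eq (support x₀ φx₀≢0)
      ... | ()

theorem3p1 : (lem : ExcludedMiddle 0ℓ) (𝓡 : CompleteOrderedField) →
  let open CompleteOrderedField 𝓡
      open Analysis lem 𝓡
  in (X : Set) → X → X ↣ ℕ → (G : Graph X) →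
     let open Graph G
     in (p : ℝ) → 1# < p →
        ((2# ^ (p - 1#)) / (p ^ p)) · (h₀ p ^± p) ≤± λ₀ p
theorem3p1 lem 𝓡 X _ _ G p 1<p = IsoperimetricConstant.cheeger-inequality lem 𝓡 G 1<p
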